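{- Let $\mathbf{k}=(k_1,\dots,k_t),\mathbf{n}=(n_1,\dots,n_t)\in\mathbb{N}^t$ with $k=\sum_i k_i$, $n=\sum_i n_i$ and $k_i<n_i$ for all $i\in[t]$. Let $U$ be an $\mathbb{F}_q$-subspace of $\mathbb{V}(k,q^m)$ which is decomposable of type $(\mathbf{k},\mathbf{n})$, with components $U_1,\dots,U_t$ and $F_i=\langle U_i\rangle_{\mathbb{F}_{q^m}}$. Then $U$ is $\mathbf{k}$-scattered with respect to the hyperplanes if and only if the only $\mathbb{F}_{q^m}$-subspaces $T$ of $\mathbb{V}(k,q^m)$ which have positive defect $\varepsilon_U(T)>0$ and are minimal with respect to their defect are the subspaces of the form $\sum_{i\in I}F_i$ with $\emptyset\neq I\subseteq[t]$.
   Context: $q$ is a prime power, $m$ a positive integer, $\mathbb{V}(k,q^m)$ a $k$-dimensional $\mathbb{F}_{q^m}$-vector space (also regarded as an $\mathbb{F}_q$-space). For an $\mathbb{F}_q$-subspace $U$ and an $\mathbb{F}_{q^m}$-subspace $T$: $w_U(T)=\dim_{\mathbb{F}_q}(U\cap T)$ and $\varepsilon_U(T)=w_U(T)-\dim_{\mathbb{F}_{q^m}}(T)$. An $\mathbb{F}_{q^m}$-subspace $T$ is minimal with respect to its defect if every proper $\mathbb{F}_{q^m}$-subspace $T'$ of $T$ satisfies $\varepsilon_U(T')<\varepsilon_U(T)$. $U$ (of $\mathbb{F}_q$-dimension $n$) is decomposable of type $(\mathbf{k},\mathbf{n})$ if $U=U_1\oplus\dots\oplus U_t$ with $\dim_{\mathbb{F}_q}U_i=n_i$,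 and $\mathbb{V}(k,q^m)=F_1\oplus\dots\oplus F_t$ where $F_i=\langle U_i\rangle_{\mathbb{F}_{q^m}}$ has $\mathbb{F}_{q^m}$-dimension $k_i$ (the order of the components is immaterial). $U$ is $\mathbf{k}$-scattered with respect to the hyperplanes (of type $\mathbf{n}$) if: (1) $U$ is decomposable of type $(\mathbf{k},\mathbf{n})$; (2) $n_i>k_i$ and each $U_i$ is scattered with respect to the hyperplanes of $F_i$, i.e. $\dim_{\mathbb{F}_q}(U_i\cap H')\le k_i-1$ for every $\mathbb{F}_{q^m}$-hyperplane $H'$ of $F_i$; (3) $\dim_{\mathbb{F}_q}(U\cap H)\le k-1$ for every $\mathbb{F}_{q^m}$-hyperplane $H$ of $\mathbb{V}(k,q^m)$ containing none of $F_1,\dots,F_t$. -}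

module Defs where

open import Level using (0ℓ)
open import Data.Nat using (ℕ; zero; suc; _+_; _<_; _≤_)
open import Data.Integer using (ℤ; +_; _-_) renaming (_<_ to _<ℤ_; _>_ to _>ℤ_)
open import Data.Fin using (Fin; zero; suc)
open import Data.Fin.Subset using (Subset; _∈_; _∉_)
open import Data.Vec using (Vec; zipWith; map; replicate)
open import Data.List using (List; length)
open import Data.List.Membership.Propositional using () renaming (_∈_ to _∈ₗ_)
open import Data.List.Relation.Unary.Unique.Propositional using (Unique)
open import Data.Product using (Σ; ∃; _×_; _,_)
open import Data.Unit using (⊤)
open import Data.Empty using (⊥)
open import Relation.Nullary using (¬_)
open import Relation.Unary using (Pred; _⊆_; _∩_) renaming (U to Full)
open import Relation.Binary.PropositionalEquality using (_≡_; _≢_)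
open import Algebra.Core using (Op₁; Op₂)
open import Algebra.Structures using (IsCommutativeRing)

record FiniteField : Set₁ where
  field
    Carrier : Set
    _+ᶠ_ _*ᶠ_ : Op₂ Carrier
    -ᶠ_ : Op₁ Carrier
    0ᶠ 1ᶠ : Carrier
    isCommutativeRing : IsCommutativeRing _≡_ _+ᶠ_ _*ᶠ_ -ᶠ_ 0ᶠ 1ᶠ
    0≢1 : 0ᶠ ≢ 1ᶠ
    inverse : ∀ x → x ≢ 0ᶠ → ∃ λ y → (x *ᶠ y) ≡ 1ᶠ
    elements : List Carrier
    complete : ∀ x → x ∈ₗ elements
    unique : Unique elements

open FiniteField public

card : FiniteField → ℕ
card F = length (elements F)

HasSize : {A : Set} → Pred A 0ℓ → ℕ → Set
HasSize {A} P q = Σ (List A) λ xs → Unique xs × (∀ x → P x → x ∈ₗ xs)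
                    × (∀ x → x ∈ₗ xs → P x) × length xs ≡ q

record IsSubfield (F : FiniteField) (K : Pred (Carrier F) 0ℓ) : Set where
  field
    has-0 : K (0ᶠ F)
    has-1 : K (1ᶠ F)
    +-closed : ∀ {x y} → K x → K y → K (_+ᶠ_ F x y)
    *-closed : ∀ {x y} → K x → K y → K (_*ᶠ_ F x y)
    neg-closed : ∀ {x} → K x → K (-ᶠ_ F x)
    inv-closed : ∀ {x y} → K x → _*ᶠ_ F x y ≡ 1ᶠ F → K y

module _ (F : FiniteField) where

  V : ℕ → Set
  V k = Vec (Carrier F) k

  AllScalars : Pred (Carrier F) 0ℓ
  AllScalars _ = ⊤

  _⊕_ : ∀ {k} → V k → V k → V k
  u ⊕ v = zipWith (_+ᶠ_ F) u v

  _·_ : ∀ {k} → Carrier F → V k → V k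
  c · v = map (_*ᶠ_ F c) v

  0v : ∀ {k} → V k
  0v = replicate _ (0ᶠ F)

  Vsum : ∀ {k d} → (Fin d → V k) → V k
  Vsum {d = zero} vs = 0v
  Vsum {d = suc d} vs = vs zero ⊕ Vsum (λ j → vs (suc j))

  lincomb : ∀ {k d} → (Fin d → Carrier F) → (Fin d → V k) → V k
  lincomb cs vs = Vsum (λ j → cs j · vs j)

  -- Subspaces over the scalar subfield S (S = K for F_q, AllScalars for F_{q^m})
  record IsSubspace (S : Pred (Carrier F) 0ℓ) {k} (W : Pred (V k) 0ℓ) : Set where
    field
      has-0 : W 0v
      ⊕-closed : ∀ {u v} → W u → W v → W (u ⊕ v)
      ·-closed : ∀ {c v} → S c → W v → W (c · v)

  Independent : (S : Pred (Carrier F) 0ℓ) → ∀ {k d} → (Fin d → V k) → Set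
  Independent S vs = ∀ cs → (∀ j → S (cs j)) → lincomb cs vs ≡ 0v → ∀ j → cs j ≡ 0ᶠ F

  Span : (S : Pred (Carrier F) 0ℓ) → ∀ {k} → Pred (V k) 0ℓ → Pred (V k) 0ℓ
  Span S X v = ∃ λ d → Σ (Fin d → V _) λ vs → (∀ j → X (vs j)) ×
                 Σ (Fin d → Carrier F) λ cs → (∀ j → S (cs j)) × v ≡ lincomb cs vs

  HasDim : (S : Pred (Carrier F) 0ℓ) → ∀ {k} → Pred (V k) 0ℓ → ℕ → Set
  HasDim S {k} W d = IsSubspace S W × Σ (Fin d → V k) λ vs →
                       Independent S vs × (∀ v → (W v → Span S (λ u → ∃ λ j → u ≡ vs j) v)
                                                 × (Span S (λ u → ∃ λ j → u ≡ vs j) v → W v))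

  IsDirectSum : ∀ {k t} → Pred (V k) 0ℓ → (Fin t → Pred (V k) 0ℓ) → Set
  IsDirectSum {k} {t} W Ws =
    (∀ v → (W v → Σ (Fin t → V k) λ us → (∀ i → Ws i (us i)) × v ≡ Vsum us)
           × (Σ (Fin t → V k) (λ us → (∀ i → Ws i (us i)) × v ≡ Vsum us) → W v))
    × (∀ us us′ → (∀ i → Ws i (us i)) → (∀ i → Ws i (us′ i)) →
         Vsum us ≡ Vsum us′ → ∀ i → us i ≡ us′ i)

  SumOver : ∀ {k t} → Subset t → (Fin t → Pred (V k) 0ℓ) → Pred (V k) 0ℓ
  SumOver {k} {t} I Ws v = Σ (Fin t → V k) λ us →
    (∀ i → (i ∈ I → Ws i (us i)) × (i ∉ I → us i ≡ 0v)) × v ≡ Vsum us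

module _ (F : FiniteField) (K : Pred (Carrier F) 0ℓ) {k t : ℕ} where

  Fcomp : (Fin t → Pred (V F k) 0ℓ) → Fin t → Pred (V F k) 0ℓ
  Fcomp Us i = Span F (AllScalars F) (Us i)

  Decomposable : (kv nv : Fin t → ℕ) → Pred (V F k) 0ℓ → (Fin t → Pred (V F k) 0ℓ) → Set
  Decomposable kv nv U Us =
    (∀ i → IsSubspace F K (Us i)) × IsDirectSum F U Us × (∀ i → HasDim F K (Us i) (nv i))
    × IsDirectSum F Full (Fcomp Us) × (∀ i → HasDim F (AllScalars F) (Fcomp Us i) (kv i))

  KScattered : (kv nv : Fin t → ℕ) → Pred (V F k) 0ℓ → (Fin t → Pred (V F k) 0ℓ) → Set₁
  KScattered kv nv U Us =
    Decomposable kv nv U Us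
    × (∀ i → kv i < nv i)
    × (∀ i (H′ : Pred (V F k) 0ℓ) (d : ℕ) → H′ ⊆ Fcomp Us i →
         HasDim F (AllScalars F) H′ d → suc d ≡ kv i →
         ∀ w → HasDim F K (Us i ∩ H′) w → w ≤ d)
    × (∀ (H : Pred (V F k) 0ℓ) (d : ℕ) →
         HasDim F (AllScalars F) H d → suc d ≡ k →
         (∀ i → ¬ (Fcomp Us i ⊆ H)) →
         ∀ w → HasDim F K (U ∩ H) w → w ≤ d)

  Defect : Pred (V F k) 0ℓ → Pred (V F k) 0ℓ → ℤ → Set
  Defect U T e = ∃ λ w → ∃ λ b → HasDim F K (U ∩ T) w × HasDim F (AllScalars F) T b
                   × e ≡ (+ w) - (+ b)

  PositiveDefect : Pred (V F k) 0ℓ → Pred (V F k) 0ℓ → Set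
  PositiveDefect U T = ∃ λ e → Defect U T e × e >ℤ + 0

  MinimalDefect : Pred (V F k) 0ℓ → Pred (V F k) 0ℓ → Set₁
  MinimalDefect U T =
    ∀ (T′ : Pred (V F k) 0ℓ) → IsSubspace F (AllScalars F) T′ → T′ ⊆ T →
      (∃ λ v → T v × ¬ T′ v) →
      ∀ e′ e → Defect U T′ e′ → Defect U T e → e′ <ℤ e

sumFin : ∀ {t} → (Fin t → ℕ) → ℕ
sumFin {zero} f = 0
sumFin {suc t} f = f zero + sumFin (λ i → f (suc i))

{-# OPTIONS --safe #-}
module Submission where

-- For an index set I write F_I for the sum of the F_i with i ∈ I.  By directness
-- ε(F_I) = Σ_{i ∈ I} (n_i − k_i), which is strictly increasing in I.
--
-- If U is k-scattered, then a hyperplane of F_D containing no F_i (i ∈ D) has defect ≤ 0, since a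
-- counterexample could be enlarged by vectors of U to a forbidden hyperplane of the whole space.
-- Put I(T) = {i : F_i ⊆ T}.  Then ε(T) ≤ ε(F_{I(T)}) for every T, by induction on the codimension:
-- for u ∈ U outside T, T′ = T + ⟨u⟩ and D = I(T′) ∖ I(T), the space T ∩ F_D is a hyperplane of F_D
-- of defect ≤ 0 (if D is nonempty), and Grassmann's formula gives ε(T) ≤ ε(T′) − ε(F_D).
-- Minimality of T therefore means T = F_{I(T)}.
--
-- Conversely, a hyperplane of positive defect contains a subspace that is minimal with positive
-- defect, that is, some F_I with I nonempty.

open import Defs
open import Level using (0ℓ)
open import Algebra.Bundles using (CommutativeSemigroup)
open import Algebra.Structures using (IsCommutativeRing)
import Algebra.Properties.CommutativeSemigroup as CommutativeSemigroupProperties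
open import Data.Bool using (Bool; true; false; not; _∧_; _∨_; if_then_else_)
import Data.Bool.Properties as Bool
open import Data.Empty using (⊥; ⊥-elim)
open import Data.Fin using (Fin; zero; suc)
import Data.Fin.Properties as Fin
open import Data.Fin.Subset using (Subset; Nonempty)
open import Data.Integer using (_-_; _⊖_) renaming (+_ to ι; _<_ to _<ℤ_; _≤_ to _≤ℤ_)
import Data.Integer.Properties as ℤ
open import Data.List using (List; []; _∷_; _++_; length; tabulate; lookup; allFin; cartesianProductWith)
open import Data.List.Membership.Propositional using (lose) renaming (_∈_ to _∈ₗ_)
open import Data.List.Membership.Propositional.Properties using (∈-allFin; ∈-cartesianProductWith⁺)
open import Data.List.Properties using (length-++; length-tabulate; tabulate-lookup)
open import Data.List.Relation.Unary.All as All using (All; []; _∷_)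
open import Data.List.Relation.Unary.All.Properties using (++⁺; tabulate⁺; tabulate⁻)
open import Data.List.Relation.Unary.Any as Any using (here; there)
open import Data.List.Relation.Unary.Any.Properties using (lookup-index)
open import Data.Nat using (ℕ; zero; suc; _+_; _^_; _≤_; _<_; z≤n; s≤s)
open import Data.Nat.Properties
import Data.Nat.Tactic.RingSolver as ℕ-Solver
open import Data.Product using (Σ; ∃; _×_; _,_; proj₁; proj₂)
open import Data.Sum using (_⊎_; inj₁; inj₂)
open import Data.Unit using (⊤; tt)
import Data.Vec as Vec
open import Data.Vec using ([]; _∷_)
open import Data.Vec.Functional using () renaming (_∷_ to _◂_)
import Data.Vec.Properties as Vec
open import Function using (_∘_; id; case_of_)
open import Function.Bundles using (_⇔_; mk⇔; module Equivalence)
open import Relation.Binary.PropositionalEquality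
open import Relation.Nullary using (¬_; Dec; yes; no; does)
open import Relation.Nullary.Decidable using (map′; _×-dec_; ¬?; dec-true; decidable-stable)
open import Relation.Unary using (Pred; Decidable; _∩_)

-- Sums of natural numbers over index sets.

sumFin-cong : ∀ {t} {f g : Fin t → ℕ} → (∀ i → f i ≡ g i) → sumFin f ≡ sumFin g
sumFin-cong {zero} f≗g = refl
sumFin-cong {suc t} f≗g = cong₂ _+_ (f≗g zero) (sumFin-cong (f≗g ∘ suc))

sumOn : ∀ {t} → (Fin t → Bool) → (Fin t → ℕ) → ℕ
sumOn I f = sumFin (λ i → if I i then f i else 0)

_∖_ : ∀ {t} → (Fin t → Bool) → (Fin t → Bool) → Fin t → Bool
(J ∖ I) i = J i ∧ not (I i)

∖-true : ∀ {t} (J I : Fin t → Bool) i → (J ∖ I) i ≡ true → J i ≡ true × I i ≡ false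
∖-true J I i eq with J i | I i
... | true | false = refl , refl

true-∖ : ∀ {t} (J I : Fin t → Bool) i → J i ≡ true → I i ≡ false → (J ∖ I) i ≡ true
true-∖ J I i eq eq′ rewrite eq | eq′ = refl

sumOn-cong : ∀ {t} (I : Fin t → Bool) {f g : Fin t → ℕ} → (∀ i → f i ≡ g i) → sumOn I f ≡ sumOn I g
sumOn-cong I f≗g = sumFin-cong (λ i → cong (if I i then_else 0) (f≗g i))

sumOn-empty : ∀ {t} (I : Fin t → Bool) f → (∀ i → I i ≢ true) → sumOn I f ≡ 0
sumOn-empty {zero} I f empty = refl
sumOn-empty {suc t} I f empty with I zero in eq
... | true = ⊥-elim (empty zero eq)
... | false = sumOn-empty (I ∘ suc) (f ∘ suc) (empty ∘ suc)

sumOn-split : ∀ {t} (J I : Fin t → Bool) f → (∀ i → I i ≡ true → J i ≡ true) →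
              sumOn J f ≡ sumOn I f + sumOn (J ∖ I) f
sumOn-split {zero} J I f I⊆J = refl
sumOn-split {suc t} J I f I⊆J with I zero in eq | J zero in eq′ | sumOn-split (J ∘ suc) (I ∘ suc) (f ∘ suc) (I⊆J ∘ suc)
... | true  | true  | ih = trans (cong (f zero +_) ih) (sym (+-assoc (f zero) _ _))
... | true  | false | ih = case trans (sym (I⊆J zero eq)) eq′ of λ ()
... | false | false | ih = ih
... | false | true  | ih = begin
  f zero + sumOn (J ∘ suc) (f ∘ suc)  ≡⟨ cong (f zero +_) ih ⟩
  f zero + (a + b)                    ≡⟨ +-assoc (f zero) a b ⟨
  (f zero + a) + b                    ≡⟨ cong (_+ b) (+-comm (f zero) a) ⟩
  (a + f zero) + b                    ≡⟨ +-assoc a (f zero) b ⟩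
  a + (f zero + b)                    ∎
  where
  open ≡-Reasoning
  a = sumOn (I ∘ suc) (f ∘ suc)
  b = sumOn ((J ∖ I) ∘ suc) (f ∘ suc)

sumOn-≤ : ∀ {t} (I : Fin t → Bool) {f g : Fin t → ℕ} → (∀ i → f i < g i) → sumOn I f ≤ sumOn I g
sumOn-≤ {zero} I f<g = z≤n
sumOn-≤ {suc t} I f<g with I zero
... | true = +-mono-≤ (<⇒≤ (f<g zero)) (sumOn-≤ (I ∘ suc) (f<g ∘ suc))
... | false = sumOn-≤ (I ∘ suc) (f<g ∘ suc)

sumOn-< : ∀ {t} (I : Fin t → Bool) {f g : Fin t → ℕ} → (∀ i → f i < g i) →
          ∀ i → I i ≡ true → sumOn I f < sumOn I g
sumOn-< I f<g zero i∈I rewrite i∈I = +-mono-<-≤ (f<g zero) (sumOn-≤ (I ∘ suc) (f<g ∘ suc))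
sumOn-< I f<g (suc i) i∈I with I zero
... | true = +-mono-< (f<g zero) (sumOn-< (I ∘ suc) (f<g ∘ suc) i i∈I)
... | false = sumOn-< (I ∘ suc) (f<g ∘ suc) i i∈I

-- Vectors over a finite field, exhaustive search and decidable subspaces.

∃-listed? : {A : Set} (xs : List A) → (∀ x → x ∈ₗ xs) → {P : Pred A 0ℓ} → Decidable P → Dec (∃ P)
∃-listed? xs complete P? =
  map′ Any.satisfied (λ (x , px) → lose (complete x) px) (Any.any? P? xs)

module VectorSpace (F : FiniteField) where

  module 𝔽 = IsCommutativeRing (isCommutativeRing F)

  infixl 6 _+ᵥ_
  infixr 7 _*ᵥ_

  _+ᵥ_ : ∀ {k} → V F k → V F k → V F k
  _+ᵥ_ = _⊕_ F

  _*ᵥ_ : ∀ {k} → Carrier F → V F k → V F k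
  _*ᵥ_ = _·_ F

  0ᵥ : ∀ {k} → V F k
  0ᵥ = 0v F

  -ᵥ_ : ∀ {k} → V F k → V F k
  -ᵥ v = (-ᶠ_ F (1ᶠ F)) *ᵥ v

  +ᵥ-assoc : ∀ {k} (u v w : V F k) → (u +ᵥ v) +ᵥ w ≡ u +ᵥ (v +ᵥ w)
  +ᵥ-assoc = Vec.zipWith-assoc 𝔽.+-assoc

  +ᵥ-comm : ∀ {k} (u v : V F k) → u +ᵥ v ≡ v +ᵥ u
  +ᵥ-comm = Vec.zipWith-comm 𝔽.+-comm

  +ᵥ-identityˡ : ∀ {k} (v : V F k) → 0ᵥ +ᵥ v ≡ v
  +ᵥ-identityˡ = Vec.zipWith-identityˡ 𝔽.+-identityˡ

  +ᵥ-identityʳ : ∀ {k} (v : V F k) → v +ᵥ 0ᵥ ≡ v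
  +ᵥ-identityʳ = Vec.zipWith-identityʳ 𝔽.+-identityʳ

  *ᵥ-distribˡ : ∀ {k} c (u v : V F k) → c *ᵥ (u +ᵥ v) ≡ c *ᵥ u +ᵥ c *ᵥ v
  *ᵥ-distribˡ c [] [] = refl
  *ᵥ-distribˡ c (x ∷ u) (y ∷ v) = cong₂ _∷_ (𝔽.distribˡ c x y) (*ᵥ-distribˡ c u v)

  *ᵥ-distribʳ : ∀ {k} c d (v : V F k) → (_+ᶠ_ F c d) *ᵥ v ≡ c *ᵥ v +ᵥ d *ᵥ v
  *ᵥ-distribʳ c d [] = refl
  *ᵥ-distribʳ c d (x ∷ v) = cong₂ _∷_ (𝔽.distribʳ x c d) (*ᵥ-distribʳ c d v)

  *ᵥ-assoc : ∀ {k} c d (v : V F k) → (_*ᶠ_ F c d) *ᵥ v ≡ c *ᵥ d *ᵥ v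
  *ᵥ-assoc c d [] = refl
  *ᵥ-assoc c d (x ∷ v) = cong₂ _∷_ (𝔽.*-assoc c d x) (*ᵥ-assoc c d v)

  *ᵥ-identityˡ : ∀ {k} (v : V F k) → 1ᶠ F *ᵥ v ≡ v
  *ᵥ-identityˡ [] = refl
  *ᵥ-identityˡ (x ∷ v) = cong₂ _∷_ (𝔽.*-identityˡ x) (*ᵥ-identityˡ v)

  *ᵥ-zeroˡ : ∀ {k} (v : V F k) → 0ᶠ F *ᵥ v ≡ 0ᵥ
  *ᵥ-zeroˡ [] = refl
  *ᵥ-zeroˡ (x ∷ v) = cong₂ _∷_ (𝔽.zeroˡ x) (*ᵥ-zeroˡ v)

  *ᵥ-zeroʳ : ∀ {k} c → c *ᵥ 0ᵥ {k} ≡ 0ᵥ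
  *ᵥ-zeroʳ {zero} c = refl
  *ᵥ-zeroʳ {suc k} c = cong₂ _∷_ (𝔽.zeroʳ c) (*ᵥ-zeroʳ {k} c)

  +ᵥ-inverseʳ : ∀ {k} (v : V F k) → v +ᵥ -ᵥ v ≡ 0ᵥ
  +ᵥ-inverseʳ v = begin
    v +ᵥ -ᵥ v            ≡⟨ cong (_+ᵥ -ᵥ v) (*ᵥ-identityˡ v) ⟨
    1ᶠ F *ᵥ v +ᵥ -ᵥ v    ≡⟨ *ᵥ-distribʳ _ _ v ⟨
    _ *ᵥ v               ≡⟨ cong (_*ᵥ v) (𝔽.-‿inverseʳ (1ᶠ F)) ⟩
    0ᶠ F *ᵥ v            ≡⟨ *ᵥ-zeroˡ v ⟩
    0ᵥ                   ∎
    where open ≡-Reasoning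

  +ᵥ-cancel-inverse : ∀ {k} (u v : V F k) → (u +ᵥ v) +ᵥ -ᵥ v ≡ u
  +ᵥ-cancel-inverse u v = begin
    (u +ᵥ v) +ᵥ -ᵥ v ≡⟨ +ᵥ-assoc u v _ ⟩
    u +ᵥ (v +ᵥ -ᵥ v) ≡⟨ cong (u +ᵥ_) (+ᵥ-inverseʳ v) ⟩
    u +ᵥ 0ᵥ          ≡⟨ +ᵥ-identityʳ u ⟩
    u                ∎
    where open ≡-Reasoning

  +ᵥ-interchange : ∀ {k} (a b c d : V F k) → (a +ᵥ b) +ᵥ (c +ᵥ d) ≡ (a +ᵥ c) +ᵥ (b +ᵥ d)
  +ᵥ-interchange {k} = CommutativeSemigroupProperties.interchange semigroup
    where
    semigroup : CommutativeSemigroup 0ℓ 0ℓ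
    semigroup = record
      { Carrier = V F k ; _≈_ = _≡_ ; _∙_ = _+ᵥ_
      ; isCommutativeSemigroup = record
        { isSemigroup = record
          { isMagma = record { isEquivalence = isEquivalence ; ∙-cong = cong₂ _+ᵥ_ }
          ; assoc = +ᵥ-assoc }
        ; comm = +ᵥ-comm } }

  infix 4 _≟ᶠ_ _≟ᵥ_

  _≟ᶠ_ : (x y : Carrier F) → Dec (x ≡ y)
  x ≟ᶠ y = map′
    (λ eq → trans (lookup-index (complete F x))
              (trans (cong (lookup (elements F)) eq) (sym (lookup-index (complete F y)))))
    (cong (Any.index ∘ complete F))
    (Any.index (complete F x) Fin.≟ Any.index (complete F y))

  _≟ᵥ_ : ∀ {k} (u v : V F k) → Dec (u ≡ v)
  _≟ᵥ_ = Vec.≡-dec _≟ᶠ_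

  vectors : ∀ k → List (V F k)
  vectors zero = [] ∷ []
  vectors (suc k) = cartesianProductWith _∷_ (elements F) (vectors k)

  vectors-complete : ∀ {k} (v : V F k) → v ∈ₗ vectors k
  vectors-complete [] = here refl
  vectors-complete (x ∷ v) = ∈-cartesianProductWith⁺ _∷_ (complete F x) (vectors-complete v)

  ∃ᶠ? : {P : Pred (Carrier F) 0ℓ} → Decidable P → Dec (∃ P)
  ∃ᶠ? = ∃-listed? (elements F) (complete F)

  ∃ᵥ? : ∀ {k} {P : Pred (V F k) 0ℓ} → Decidable P → Dec (∃ P)
  ∃ᵥ? {k} = ∃-listed? (vectors k) vectors-complete

-- Each predicate bundled this way below has a finite basis or is built from subspaces that have
-- one, so membership is decidable. Carrying the decision along makes the classical case
-- distinctions constructive.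
record Subspace (F : FiniteField) (S : Pred (Carrier F) 0ℓ) (k : ℕ) : Set₁ where
  field
    Contains   : Pred (V F k) 0ℓ
    isSubspace : IsSubspace F S Contains
    contains?  : Decidable Contains

open Subspace

module _ {F : FiniteField} {k : ℕ} where

  infix 4 _∈_ _∉_ _⊑_

  _∈_ : ∀ {S} → V F k → Subspace F S k → Set
  v ∈ A = Contains A v

  _∉_ : ∀ {S} → V F k → Subspace F S k → Set
  v ∉ A = ¬ v ∈ A

  _⊑_ : ∀ {S S′} → Subspace F S k → Subspace F S′ k → Set
  A ⊑ B = ∀ {v} → v ∈ A → v ∈ B

  -- The space is finite, so a search through all its vectors settles the inclusion. The two scalar
  -- sets may differ, which allows `U` to be compared with a subspace over the large field.
  ⊑-or-witness : ∀ {S S′} (A : Subspace F S k) (B : Subspace F S′ k) →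
                 A ⊑ B ⊎ ∃ λ v → v ∈ A × v ∉ B
  ⊑-or-witness A B with VectorSpace.∃ᵥ? F (λ v → contains? A v ×-dec ¬? (contains? B v))
  ... | yes w = inj₂ w
  ... | no ¬w = inj₁ λ {v} v∈A → decidable-stable (contains? B v) (λ v∉B → ¬w (v , v∈A , v∉B))

  ⊑-dec : ∀ {S S′} (A : Subspace F S k) (B : Subspace F S′ k) → Dec (A ⊑ B)
  ⊑-dec A B with ⊑-or-witness A B
  ... | inj₁ A⊑B = yes A⊑B
  ... | inj₂ (v , v∈A , v∉B) = no λ A⊑B → v∉B (A⊑B v∈A)

-- Lattice of subspaces over a subfield of scalars.

module LinearAlgebra (F : FiniteField) {S : Pred (Carrier F) 0ℓ} (S-subfield : IsSubfield F S)
                     (S? : Decidable S) {k : ℕ} where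

  open VectorSpace F
  open IsSubfield S-subfield renaming (has-0 to 0∈S)

  Sub : Set₁
  Sub = Subspace F S k

  module _ (A : Sub) where
    open IsSubspace (isSubspace A)

    0ᵥ∈ : 0ᵥ ∈ A
    0ᵥ∈ = has-0

    +ᵥ∈ : ∀ {u v} → u ∈ A → v ∈ A → u +ᵥ v ∈ A
    +ᵥ∈ = ⊕-closed

    *ᵥ∈ : ∀ {c v} → S c → v ∈ A → c *ᵥ v ∈ A
    *ᵥ∈ = ·-closed

    -ᵥ∈ : ∀ {v} → v ∈ A → -ᵥ v ∈ A
    -ᵥ∈ = *ᵥ∈ (neg-closed has-1)

    cancelʳ∈ : ∀ u {v} → u +ᵥ v ∈ A → v ∈ A → u ∈ A
    cancelʳ∈ u {v} u+v∈A v∈A = subst (_∈ A) (+ᵥ-cancel-inverse u v) (+ᵥ∈ u+v∈A (-ᵥ∈ v∈A))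

    cancelˡ∈ : ∀ {u} v → u +ᵥ v ∈ A → u ∈ A → v ∈ A
    cancelˡ∈ v u+v∈A = cancelʳ∈ v (subst (_∈ A) (+ᵥ-comm _ v) u+v∈A)

    unscale∈ : ∀ {c v} → S c → c ≢ 0ᶠ F → c *ᵥ v ∈ A → v ∈ A
    unscale∈ {c} {v} Sc c≢0 cv∈A with d , cd≡1 ← inverse F c c≢0 =
      subst (_∈ A) eq (*ᵥ∈ (inv-closed Sc cd≡1) cv∈A)
      where
      eq : d *ᵥ c *ᵥ v ≡ v
      eq = trans (sym (*ᵥ-assoc d c v))
             (trans (cong (_*ᵥ v) (trans (𝔽.*-comm d c) cd≡1)) (*ᵥ-identityˡ v))

  trivial : Sub
  trivial = record
    { Contains = _≡ 0ᵥ
    ; isSubspace = record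
      { has-0 = refl
      ; ⊕-closed = λ { refl refl → +ᵥ-identityˡ 0ᵥ }
      ; ·-closed = λ { {c} _ refl → *ᵥ-zeroʳ c } }
    ; contains? = _≟ᵥ 0ᵥ }

  infixl 7 _⊓_
  infixl 6 _⊞_

  _⊓_ : Sub → Sub → Sub
  A ⊓ B = record
    { Contains = Contains A ∩ Contains B
    ; isSubspace = record
      { has-0 = 0ᵥ∈ A , 0ᵥ∈ B
      ; ⊕-closed = λ (a , b) (a′ , b′) → +ᵥ∈ A a a′ , +ᵥ∈ B b b′
      ; ·-closed = λ Sc (a , b) → *ᵥ∈ A Sc a , *ᵥ∈ B Sc b }
    ; contains? = λ v → contains? A v ×-dec contains? B v }

  _⊞_ : Sub → Sub → Sub
  A ⊞ B = record
    { Contains = λ v → ∃ λ a → a ∈ A × ∃ λ b → b ∈ B × v ≡ a +ᵥ b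
    ; isSubspace = record
      { has-0 = 0ᵥ , 0ᵥ∈ A , 0ᵥ , 0ᵥ∈ B , sym (+ᵥ-identityˡ 0ᵥ)
      ; ⊕-closed = λ { (a , a∈ , b , b∈ , refl) (a′ , a′∈ , b′ , b′∈ , refl) →
          _ , +ᵥ∈ A a∈ a′∈ , _ , +ᵥ∈ B b∈ b′∈ , +ᵥ-interchange a b a′ b′ }
      ; ·-closed = λ { {c} Sc (a , a∈ , b , b∈ , refl) →
          _ , *ᵥ∈ A Sc a∈ , _ , *ᵥ∈ B Sc b∈ , *ᵥ-distribˡ c a b } }
    ; contains? = λ v → ∃ᵥ? λ a → contains? A a ×-dec ∃ᵥ? λ b → contains? B b ×-dec v ≟ᵥ a +ᵥ b }

  ⊑-⊞ˡ : ∀ A B → A ⊑ A ⊞ B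
  ⊑-⊞ˡ A B v∈A = _ , v∈A , 0ᵥ , 0ᵥ∈ B , sym (+ᵥ-identityʳ _)

  ⊑-⊞ʳ : ∀ A B → B ⊑ A ⊞ B
  ⊑-⊞ʳ A B v∈B = 0ᵥ , 0ᵥ∈ A , _ , v∈B , sym (+ᵥ-identityˡ _)

  ⊞-least : ∀ A B (C : Sub) → A ⊑ C → B ⊑ C → A ⊞ B ⊑ C
  ⊞-least A B C A⊑C B⊑C (a , a∈A , b , b∈B , refl) = +ᵥ∈ C (A⊑C a∈A) (B⊑C b∈B)

  adjoin : Sub → V F k → Sub
  adjoin B x = record
    { Contains = λ v → ∃ λ c → S c × ∃ λ b → b ∈ B × v ≡ b +ᵥ c *ᵥ x
    ; isSubspace = record
      { has-0 = 0ᶠ F , 0∈S , 0ᵥ , 0ᵥ∈ B , sym (trans (+ᵥ-identityˡ _) (*ᵥ-zeroˡ x))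
      ; ⊕-closed = λ { (c , Sc , b , b∈ , refl) (c′ , Sc′ , b′ , b′∈ , refl) →
          _ , +-closed Sc Sc′ , _ , +ᵥ∈ B b∈ b′∈ ,
          trans (+ᵥ-interchange b (c *ᵥ x) b′ (c′ *ᵥ x)) (cong (_ +ᵥ_) (sym (*ᵥ-distribʳ c c′ x))) }
      ; ·-closed = λ { {d} Sd (c , Sc , b , b∈ , refl) →
          _ , *-closed Sd Sc , _ , *ᵥ∈ B Sd b∈ ,
          trans (*ᵥ-distribˡ d b (c *ᵥ x)) (cong (_ +ᵥ_) (sym (*ᵥ-assoc d c x))) } }
    ; contains? = λ v → ∃ᶠ? λ c → S? c ×-dec ∃ᵥ? λ b → contains? B b ×-dec v ≟ᵥ b +ᵥ c *ᵥ x }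

  ⊑-adjoin : ∀ B x → B ⊑ adjoin B x
  ⊑-adjoin B x v∈B = 0ᶠ F , 0∈S , _ , v∈B ,
    sym (trans (cong (_ +ᵥ_) (*ᵥ-zeroˡ x)) (+ᵥ-identityʳ _))

  ∈-adjoin : ∀ B x → x ∈ adjoin B x
  ∈-adjoin B x = 1ᶠ F , has-1 , 0ᵥ , 0ᵥ∈ B , sym (trans (+ᵥ-identityˡ _) (*ᵥ-identityˡ x))

  adjoin-least : ∀ B x (C : Sub) → B ⊑ C → x ∈ C → adjoin B x ⊑ C
  adjoin-least B x C B⊑C x∈C (c , Sc , b , b∈B , refl) = +ᵥ∈ C (B⊑C b∈B) (*ᵥ∈ C Sc x∈C)

  adjoin-mono : ∀ B C x → B ⊑ C → adjoin B x ⊑ adjoin C x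
  adjoin-mono B C x B⊑C = adjoin-least B x (adjoin C x) (⊑-adjoin C x ∘ B⊑C) (∈-adjoin C x)

  -- The coefficient of `x` in `y` is nonzero because `y` lies outside `B`, so the relation can be
  -- solved for `x`.
  exchange : ∀ B {x y} → y ∈ adjoin B x → y ∉ B → x ∈ adjoin B y
  exchange B {x} {y} (c , Sc , b , b∈B , refl) y∉B =
    unscale∈ (adjoin B y) Sc c≢0
      (cancelˡ∈ (adjoin B y) (c *ᵥ x) (∈-adjoin B y) (⊑-adjoin B y b∈B))
    where
    c≢0 : c ≢ 0ᶠ F
    c≢0 refl = y∉B (subst (_∈ B) (sym (trans (cong (b +ᵥ_) (*ᵥ-zeroˡ x)) (+ᵥ-identityʳ b))) b∈B)

  -- Relative independence and the Steinitz bound.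

  span : Sub → List (V F k) → Sub
  span B [] = B
  span B (x ∷ xs) = adjoin (span B xs) x

  ⊑-span : ∀ B xs → B ⊑ span B xs
  ⊑-span B [] v∈B = v∈B
  ⊑-span B (x ∷ xs) v∈B = ⊑-adjoin (span B xs) x (⊑-span B xs v∈B)

  ∈-span : ∀ B xs → All (_∈ span B xs) xs
  ∈-span B [] = []
  ∈-span B (x ∷ xs) = ∈-adjoin (span B xs) x ∷ All.map (⊑-adjoin (span B xs) x) (∈-span B xs)

  span-least : ∀ B xs (C : Sub) → B ⊑ C → All (_∈ C) xs → span B xs ⊑ C
  span-least B [] C B⊑C [] = B⊑C
  span-least B (x ∷ xs) C B⊑C (x∈C ∷ xs∈C) =
    adjoin-least (span B xs) x C (span-least B xs C B⊑C xs∈C) x∈C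

  span-mono : ∀ {B C} xs → B ⊑ C → span B xs ⊑ span C xs
  span-mono {B} {C} xs B⊑C = span-least B xs (span C xs) (⊑-span C xs ∘ B⊑C) (∈-span C xs)

  -- This is linear independence in the quotient by `B`, expressed without forming quotients. With
  -- `B` trivial it is ordinary independence.
  IndependentMod : Sub → List (V F k) → Set
  IndependentMod B [] = ⊤
  IndependentMod B (x ∷ xs) = x ∉ span B xs × IndependentMod B xs

  independent-antitone : ∀ {B C} xs → C ⊑ B → IndependentMod B xs → IndependentMod C xs
  independent-antitone [] C⊑B _ = tt
  independent-antitone (x ∷ xs) C⊑B (x∉ , ind) =
    x∉ ∘ span-mono xs C⊑B , independent-antitone xs C⊑B ind

  -- Enlarging the modulus by one vector costs at most one member of an independent list.
  drop-one : ∀ B x ys → IndependentMod B ys → IndependentMod (adjoin B x) ys ⊎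
    (x ∈ span B ys × ∃ λ ys′ → suc (length ys′) ≡ length ys × IndependentMod (adjoin B x) ys′
                               × All (_∈ span B ys) ys′)
  drop-one B x [] ind = inj₁ tt
  drop-one B x (y ∷ ys) (y∉ , ind) with drop-one B x ys ind
  ... | inj₂ (x∈ , ys′ , len , ind′ , ys′⊆) =
    inj₂ (⊑-adjoin (span B ys) y x∈ , y ∷ ys′ , cong suc len ,
          (y∉ ∘ span-least (adjoin B x) ys′ (span B ys) (adjoin-least B x (span B ys) (⊑-span B ys) x∈) ys′⊆ , ind′) ,
          ∈-adjoin (span B ys) y ∷ All.map (⊑-adjoin (span B ys) y) ys′⊆)
  ... | inj₁ ind′ with contains? (span (adjoin B x) ys) y
  ...   | no y∉′ = inj₁ (y∉′ , ind′)
  ...   | yes y∈ = inj₂ (exchange (span B ys) y∈adj y∉ , ys , refl , ind′ ,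
                         All.map (⊑-adjoin (span B ys) y) (∈-span B ys))
    where
    y∈adj : y ∈ adjoin (span B ys) x
    y∈adj = span-least (adjoin B x) ys (adjoin (span B ys) x) (adjoin-mono B (span B ys) x (⊑-span B ys))
              (All.map (⊑-adjoin (span B ys) x) (∈-span B ys)) y∈

  -- Steinitz: the generators `xs` move into the modulus one at a time, and by `drop-one` each costs
  -- at most one vector of `ys`. Once all have moved, nothing independent can remain.
  independent-≤-spanning : ∀ B ys xs → IndependentMod B ys → All (_∈ span B xs) ys →
                           length ys ≤ length xs
  independent-≤-spanning B [] xs ind ys∈ = z≤n
  independent-≤-spanning B (y ∷ ys) [] (y∉ , _) (y∈ ∷ _) = ⊥-elim (y∉ (⊑-span B ys y∈))
  independent-≤-spanning B ys@(_ ∷ _) (x ∷ xs) ind ys∈ with drop-one B x ys ind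
  ... | inj₁ ind′ = m≤n⇒m≤1+n (independent-≤-spanning (adjoin B x) ys xs ind′ (All.map reorder ys∈))
    where
    reorder : adjoin (span B xs) x ⊑ span (adjoin B x) xs
    reorder = adjoin-least (span B xs) x (span (adjoin B x) xs) (span-mono xs (⊑-adjoin B x))
                (⊑-span (adjoin B x) xs (∈-adjoin B x))
  ... | inj₂ (_ , ys′ , len , ind′ , ys′∈) =
    subst (_≤ suc (length xs)) len
      (s≤s (independent-≤-spanning (adjoin B x) ys′ xs ind′ (All.map reorder ys′∈)))
    where
    reorder : span B ys ⊑ span (adjoin B x) xs
    reorder = span-least B ys (span (adjoin B x) xs)
                (⊑-span (adjoin B x) xs ∘ ⊑-adjoin B x)
                (All.map (adjoin-least (span B xs) x (span (adjoin B x) xs)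
                            (span-mono xs (⊑-adjoin B x))
                            (⊑-span (adjoin B x) xs (∈-adjoin B x))) ys∈)

  -- Bases, dimension and Grassmann's formula.

  record BasisMod (B A : Sub) : Set where
    field
      basis       : List (V F k)
      independent : IndependentMod B basis
      spans       : A ⊑ span B basis
      inside      : All (_∈ A) basis

  open BasisMod

  basisMod : ∀ B A → BasisMod B A
  basisMod B A = record
    { basis = proj₁ greedy ; independent = proj₁ (proj₂ greedy)
    ; spans = λ {v} → All.lookup (proj₂ (proj₂ (proj₂ greedy))) (vectors-complete v)
    ; inside = proj₁ (proj₂ (proj₂ greedy)) }
    where
    -- Greedy choice: a vector of `A` is kept when it enlarges the span. The last component records
    -- that the members of `A` scanned so far are spanned, so scanning all vectors yields a basis.
    extend : ∀ L → ∃ λ xs → IndependentMod B xs × All (_∈ A) xs × All (λ v → v ∈ A → v ∈ span B xs) L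
    extend [] = [] , tt , [] , []
    extend (v ∷ L) with extend L
    ... | xs , ind , xs∈A , done with contains? A v | contains? (span B xs) v
    ...   | no v∉A | _ = xs , ind , xs∈A , (⊥-elim ∘ v∉A) ∷ done
    ...   | yes _ | yes v∈ = xs , ind , xs∈A , (λ _ → v∈) ∷ done
    ...   | yes v∈A | no v∉ = v ∷ xs , (v∉ , ind) , v∈A ∷ xs∈A ,
      (λ _ → ∈-adjoin (span B xs) v) ∷ All.map (λ f u∈A → ⊑-adjoin (span B xs) v (f u∈A)) done
    greedy = extend (vectors k)

  -- A total function, in contrast to the relation `HasDim`; the two are linked by `hasDim⇒dim` and
  -- `dim⇒hasDim`.
  dim : Sub → ℕ
  dim A = length (basis (basisMod trivial A))

  trivial-⊑ : ∀ A → trivial ⊑ A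
  trivial-⊑ A refl = 0ᵥ∈ A

  dim-unique : ∀ A xs → IndependentMod trivial xs → All (_∈ A) xs → A ⊑ span trivial xs →
               dim A ≡ length xs
  dim-unique A xs ind xs∈A A⊑ = ≤-antisym
    (independent-≤-spanning trivial (basis b) xs (independent b) (All.map A⊑ (inside b)))
    (independent-≤-spanning trivial xs (basis b) ind (All.map (spans b) xs∈A))
    where b = basisMod trivial A

  span-++ : ∀ B xs ys → span (span B ys) xs ⊑ span B (xs ++ ys)
  span-++ B [] ys v∈ = v∈
  span-++ B (x ∷ xs) ys = adjoin-mono (span (span B ys) xs) (span B (xs ++ ys)) x (span-++ B xs ys)

  span-++⁻ : ∀ B xs ys → span B (xs ++ ys) ⊑ span (span B ys) xs
  span-++⁻ B [] ys v∈ = v∈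
  span-++⁻ B (x ∷ xs) ys = adjoin-mono (span B (xs ++ ys)) (span (span B ys) xs) x (span-++⁻ B xs ys)

  independent-++ : ∀ B xs ys → IndependentMod (span B ys) xs → IndependentMod B ys →
                   IndependentMod B (xs ++ ys)
  independent-++ B [] ys _ ind = ind
  independent-++ B (x ∷ xs) ys (x∉ , ind-xs) ind =
    x∉ ∘ span-++⁻ B xs ys , independent-++ B xs ys ind-xs ind

  -- A basis of `A` modulo `B` followed by a basis of `B` is a basis of `A`.
  dim-relative : ∀ {A B} xs → B ⊑ A → IndependentMod B xs → All (_∈ A) xs → A ⊑ span B xs →
                 dim A ≡ length xs + dim B
  dim-relative {A} {B} xs B⊑A ind xs∈A A⊑ = trans
    (dim-unique A (xs ++ bs)
      (independent-++ trivial xs bs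
        (independent-antitone xs (span-least trivial bs B (trivial-⊑ B) (inside b)) ind)
        (independent b))
      (++⁺ xs∈A (All.map B⊑A (inside b)))
      (span-++ trivial xs bs ∘ span-mono xs (spans b) ∘ A⊑))
    (length-++ xs)
    where
    b = basisMod trivial B
    bs = basis b

  dim-mono : ∀ {A B} → A ⊑ B → dim A ≤ dim B
  dim-mono {A} {B} A⊑B = subst (dim A ≤_)
    (sym (dim-relative (basis r) A⊑B (independent r) (inside r) (spans r))) (m≤n+m _ _)
    where r = basisMod A B

  dim-cong : ∀ {A B} → A ⊑ B → B ⊑ A → dim A ≡ dim B
  dim-cong A⊑B B⊑A = ≤-antisym (dim-mono A⊑B) (dim-mono B⊑A)

  dim-strict : ∀ {A B} → A ⊑ B → ∀ {v} → v ∈ B → v ∉ A → dim A < dim B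
  dim-strict {A} {B} A⊑B {v} v∈B v∉A with basisMod A B
  ... | record { basis = [] ; spans = B⊑A } = ⊥-elim (v∉A (B⊑A v∈B))
  ... | record { basis = x ∷ xs ; independent = ind ; spans = sp ; inside = ins } =
    subst (dim A <_) (sym (dim-relative (x ∷ xs) A⊑B ind ins sp)) (s≤s (m≤n+m _ _))

  dim-full : ∀ {A B} → A ⊑ B → dim B ≤ dim A → B ⊑ A
  dim-full {A} {B} A⊑B le {v} v∈B =
    decidable-stable (contains? A v) λ v∉A → <⇒≱ (dim-strict {A} {B} A⊑B v∈B v∉A) le

  dim-trivial : ∀ {A} → A ⊑ trivial → dim A ≡ 0
  dim-trivial {A} A⊑0 = dim-unique A [] tt [] A⊑0

  dim-adjoin-∉ : ∀ A {x} → x ∉ A → dim (adjoin A x) ≡ suc (dim A)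
  dim-adjoin-∉ A {x} x∉A =
    dim-relative (x ∷ []) (⊑-adjoin A x) (x∉A , tt) (∈-adjoin A x ∷ []) id

  -- The helper `restrict` is the modular law: as `xs` lies in `A`, a vector of `A` in the span of
  -- `B` and `xs` has its `B`-part in `A` as well.
  independent-⊓ : ∀ A B xs → All (_∈ A) xs → IndependentMod (A ⊓ B) xs → IndependentMod B xs
  independent-⊓ A B [] _ _ = tt
  independent-⊓ A B (x ∷ xs) (x∈A ∷ xs∈A) (x∉ , ind) =
    x∉ ∘ restrict xs xs∈A x∈A , independent-⊓ A B xs xs∈A ind
    where
    restrict : ∀ xs → All (_∈ A) xs → ∀ {v} → v ∈ A → v ∈ span B xs → v ∈ span (A ⊓ B) xs
    restrict [] [] v∈A v∈B = v∈A , v∈B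
    restrict (x ∷ xs) (x∈A ∷ xs∈A) v∈A (c , Sc , b , b∈ , refl) =
      c , Sc , b , restrict xs xs∈A (cancelʳ∈ A b v∈A (*ᵥ∈ A Sc x∈A)) b∈ , refl

  -- A basis of `A` modulo `A ⊓ B` is also a basis of `A ⊞ B` modulo `B`, as in the second
  -- isomorphism theorem.
  grassmann : ∀ A B → dim (A ⊞ B) + dim (A ⊓ B) ≡ dim A + dim B
  grassmann A B = begin
    dim (A ⊞ B) + dim (A ⊓ B)              ≡⟨ cong (_+ dim (A ⊓ B)) dim-⊞ ⟩
    (length xs + dim B) + dim (A ⊓ B)      ≡⟨ +-assoc (length xs) _ _ ⟩
    length xs + (dim B + dim (A ⊓ B))      ≡⟨ cong (length xs +_) (+-comm (dim B) _) ⟩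
    length xs + (dim (A ⊓ B) + dim B)      ≡⟨ +-assoc (length xs) _ _ ⟨
    (length xs + dim (A ⊓ B)) + dim B      ≡⟨ cong (_+ dim B) dim-A ⟨
    dim A + dim B                          ∎
    where
    open ≡-Reasoning
    r = basisMod (A ⊓ B) A
    xs = basis r
    dim-A : dim A ≡ length xs + dim (A ⊓ B)
    dim-A = dim-relative xs proj₁ (independent r) (inside r) (spans r)
    dim-⊞ : dim (A ⊞ B) ≡ length xs + dim B
    dim-⊞ = dim-relative xs (⊑-⊞ʳ A B) (independent-⊓ A B xs (inside r) (independent r))
      (All.map (⊑-⊞ˡ A B) (inside r))
      (⊞-least A B (span B xs) (span-mono xs proj₂ ∘ spans r) (⊑-span B xs))

  -- Comparison with linear combinations and `HasDim`.

  Vsum∈ : ∀ (A : Sub) {d} (us : Fin d → V F k) → (∀ j → us j ∈ A) → Vsum F us ∈ A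
  Vsum∈ A {zero} us us∈ = 0ᵥ∈ A
  Vsum∈ A {suc d} us us∈ = +ᵥ∈ A (us∈ zero) (Vsum∈ A (us ∘ suc) (us∈ ∘ suc))

  lincomb∈ : ∀ (A : Sub) {d} {cs : Fin d → Carrier F} {vs : Fin d → V F k} →
             (∀ j → S (cs j)) → (∀ j → vs j ∈ A) → lincomb F cs vs ∈ A
  lincomb∈ A Scs vs∈ = Vsum∈ A _ (λ j → *ᵥ∈ A (Scs j) (vs∈ j))

  generator∈ : ∀ {d} (vs : Fin d → V F k) j → vs j ∈ span trivial (tabulate vs)
  generator∈ vs = tabulate⁻ (∈-span trivial (tabulate vs))

  span⇒lincomb : ∀ {d} (vs : Fin d → V F k) {v} → v ∈ span trivial (tabulate vs) →
                 ∃ λ cs → (∀ j → S (cs j)) × v ≡ lincomb F cs vs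
  span⇒lincomb {zero} vs v≡0 = (λ ()) , (λ ()) , v≡0
  span⇒lincomb {suc d} vs (c , Sc , b , b∈ , refl) with span⇒lincomb (vs ∘ suc) b∈
  ... | cs , Scs , refl = c ◂ cs , (λ { zero → Sc ; (suc j) → Scs j }) , +ᵥ-comm b _

  independent⇒independentMod : ∀ {d} {vs : Fin d → V F k} → Independent F S vs →
                               IndependentMod trivial (tabulate vs)
  independent⇒independentMod {zero} ind = tt
  independent⇒independentMod {suc d} {vs} ind = head∉ , independent⇒independentMod tail
    where
    x = vs zero
    head∉ : x ∉ span trivial (tabulate (vs ∘ suc))
    head∉ x∈ with span⇒lincomb (vs ∘ suc) x∈
    ... | cs , Scs , x≡ = 0≢1 F (sym 1≡0)
      where
      open ≡-Reasoning
      -- If the head is a combination of the tail, giving it the coefficient `-1` produces a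
      -- relation, which independence forces to be trivial.
      -1≡0 : -ᶠ_ F (1ᶠ F) ≡ 0ᶠ F
      -1≡0 = ind (-ᶠ_ F (1ᶠ F) ◂ cs) (λ { zero → neg-closed has-1 ; (suc j) → Scs j })
               (trans (cong (-ᵥ x +ᵥ_) (sym x≡)) (trans (+ᵥ-comm _ x) (+ᵥ-inverseʳ x))) zero
      1≡0 : 1ᶠ F ≡ 0ᶠ F
      1≡0 = begin
        1ᶠ F                          ≡⟨ 𝔽.+-identityʳ _ ⟨
        _+ᶠ_ F (1ᶠ F) (0ᶠ F)          ≡⟨ cong (_+ᶠ_ F (1ᶠ F)) -1≡0 ⟨
        _+ᶠ_ F (1ᶠ F) (-ᶠ_ F (1ᶠ F))  ≡⟨ 𝔽.-‿inverseʳ _ ⟩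
        0ᶠ F                          ∎
    tail : Independent F S (vs ∘ suc)
    tail cs Scs eq j = ind (0ᶠ F ◂ cs) (λ { zero → 0∈S ; (suc j) → Scs j })
      (trans (cong₂ _+ᵥ_ (*ᵥ-zeroˡ x) eq) (+ᵥ-identityˡ 0ᵥ)) (suc j)

  independentMod⇒independent : ∀ {d} {vs : Fin d → V F k} →
                               IndependentMod trivial (tabulate vs) → Independent F S vs
  independentMod⇒independent {suc d} {vs} (x∉ , ind) cs Scs eq = λ
    { zero → c≡0
    ; (suc j) → independentMod⇒independent ind (cs ∘ suc) (Scs ∘ suc) rest≡0 j }
    where
    tl = span trivial (tabulate (vs ∘ suc))
    rest = lincomb F (cs ∘ suc) (vs ∘ suc)
    rest∈ : rest ∈ tl
    rest∈ = lincomb∈ tl (Scs ∘ suc) (generator∈ (vs ∘ suc))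
    c≡0 : cs zero ≡ 0ᶠ F
    c≡0 = decidable-stable (cs zero ≟ᶠ 0ᶠ F) λ c≢0 → x∉
      (unscale∈ tl (Scs zero) c≢0 (cancelʳ∈ tl _ (subst (_∈ tl) (sym eq) (0ᵥ∈ tl)) rest∈))
    rest≡0 : rest ≡ 0ᵥ
    rest≡0 = begin
      rest                            ≡⟨ +ᵥ-identityˡ rest ⟨
      0ᵥ +ᵥ rest                      ≡⟨ cong (_+ᵥ rest) (*ᵥ-zeroˡ (vs zero)) ⟨
      0ᶠ F *ᵥ vs zero +ᵥ rest         ≡⟨ cong (λ c → c *ᵥ vs zero +ᵥ rest) c≡0 ⟨
      cs zero *ᵥ vs zero +ᵥ rest      ≡⟨ eq ⟩
      0ᵥ                              ∎
      where open ≡-Reasoning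

  Generated : ∀ {d} → (Fin d → V F k) → Pred (V F k) 0ℓ
  Generated vs = Span F S (λ u → ∃ λ j → u ≡ vs j)

  generated⇒span : ∀ {d} (vs : Fin d → V F k) {v} → Generated vs v → v ∈ span trivial (tabulate vs)
  generated⇒span vs (_ , ws , gen , cs , Scs , refl) = lincomb∈ (span trivial (tabulate vs)) Scs
    (λ j → subst (_∈ span trivial (tabulate vs)) (sym (proj₂ (gen j))) (generator∈ vs (proj₁ (gen j))))

  span⇒generated : ∀ {d} (vs : Fin d → V F k) {v} → v ∈ span trivial (tabulate vs) → Generated vs v
  span⇒generated vs v∈ with cs , Scs , v≡ ← span⇒lincomb vs v∈ =
    _ , vs , (λ j → j , refl) , cs , Scs , v≡

  hasDim⇒subspace : ∀ {W d} → HasDim F S W d → Sub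
  hasDim⇒subspace {W} (sub , vs , _ , W⇔) = record
    { Contains = W ; isSubspace = sub
    ; contains? = λ v → map′ (proj₂ (W⇔ v) ∘ span⇒generated vs) (generated⇒span vs ∘ proj₁ (W⇔ v))
                             (contains? (span trivial (tabulate vs)) v) }

  hasDim⇒dim : ∀ (A : Sub) {d} → HasDim F S (Contains A) d → dim A ≡ d
  hasDim⇒dim A (_ , vs , ind , A⇔) = trans
    (dim-unique A (tabulate vs) (independent⇒independentMod ind)
      (tabulate⁺ (λ j → proj₂ (A⇔ _) (span⇒generated vs (generator∈ vs j))))
      (λ {v} → generated⇒span vs ∘ proj₁ (A⇔ v)))
    (length-tabulate vs)

  dim⇒hasDim : ∀ (A : Sub) → HasDim F S (Contains A) (dim A)
  dim⇒hasDim A = isSubspace A , lookup xs ,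
    independentMod⇒independent (subst (IndependentMod trivial) (sym xs≡) (independent b)) ,
    λ v → (λ v∈A → span⇒generated (lookup xs) (subst (λ ys → v ∈ span trivial ys) (sym xs≡) (spans b v∈A))) ,
          (λ v∈ → span-least trivial xs A (trivial-⊑ A) (inside b)
                    (subst (λ ys → v ∈ span trivial ys) xs≡ (generated⇒span (lookup xs) v∈)))
    where
    b = basisMod trivial A
    xs = basis b
    xs≡ : tabulate (lookup xs) ≡ xs
    xs≡ = tabulate-lookup xs

  -- Direct sums and partial sums of a family.

  ⨁ : ∀ {t} → (Fin t → Sub) → Sub
  ⨁ {zero} A = trivial
  ⨁ {suc t} A = A zero ⊞ ⨁ (A ∘ suc)

  Vsum∈⨁ : ∀ {t} (A : Fin t → Sub) {us} → (∀ i → us i ∈ A i) → Vsum F us ∈ ⨁ A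
  Vsum∈⨁ {zero} A us∈ = refl
  Vsum∈⨁ {suc t} A us∈ = _ , us∈ zero , _ , Vsum∈⨁ (A ∘ suc) (us∈ ∘ suc) , refl

  ∈⨁⇒Vsum : ∀ {t} (A : Fin t → Sub) {v} → v ∈ ⨁ A → ∃ λ us → (∀ i → us i ∈ A i) × v ≡ Vsum F us
  ∈⨁⇒Vsum {zero} A v≡0 = (λ ()) , (λ ()) , v≡0
  ∈⨁⇒Vsum {suc t} A (a , a∈ , b , b∈ , refl) with ∈⨁⇒Vsum (A ∘ suc) b∈
  ... | us , us∈ , refl = a ◂ us , (λ { zero → a∈ ; (suc i) → us∈ i }) , refl

  ⊑-⨁ : ∀ {t} (A : Fin t → Sub) i → A i ⊑ ⨁ A
  ⊑-⨁ A zero = ⊑-⊞ˡ (A zero) (⨁ (A ∘ suc))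
  ⊑-⨁ A (suc i) = ⊑-⊞ʳ (A zero) (⨁ (A ∘ suc)) ∘ ⊑-⨁ (A ∘ suc) i

  ⨁-least : ∀ {t} (A : Fin t → Sub) (C : Sub) → (∀ i → A i ⊑ C) → ⨁ A ⊑ C
  ⨁-least {zero} A C A⊑C = trivial-⊑ C
  ⨁-least {suc t} A C A⊑C =
    ⊞-least (A zero) (⨁ (A ∘ suc)) C (A⊑C zero) (⨁-least (A ∘ suc) C (λ i → A⊑C (suc i)))

  -- Directness enters as uniqueness of the decomposition of zero. It makes the first summand meet
  -- the rest trivially: a common vector `v` yields a zero sum with first term `-ᵥ v`. Grassmann's
  -- formula then adds the dimensions.
  dim-⨁ : ∀ {t} (A : Fin t → Sub) →
    (∀ us → (∀ i → us i ∈ A i) → Vsum F us ≡ 0ᵥ → ∀ i → us i ≡ 0ᵥ) →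
    dim (⨁ A) ≡ sumFin (dim ∘ A)
  dim-⨁ {zero} A direct = dim-trivial {trivial} id
  dim-⨁ {suc t} A direct = begin
    dim (A₀ ⊞ B)                  ≡⟨ +-identityʳ _ ⟨
    dim (A₀ ⊞ B) + 0              ≡⟨ cong (dim (A₀ ⊞ B) +_) (dim-trivial {A₀ ⊓ B} disjoint) ⟨
    dim (A₀ ⊞ B) + dim (A₀ ⊓ B)   ≡⟨ grassmann A₀ B ⟩
    dim A₀ + dim B                ≡⟨ cong (dim A₀ +_) (dim-⨁ (A ∘ suc) direct-tail) ⟩
    dim A₀ + sumFin (dim ∘ A ∘ suc) ∎
    where
    open ≡-Reasoning
    A₀ = A zero
    B = ⨁ (A ∘ suc)
    disjoint : A₀ ⊓ B ⊑ trivial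
    disjoint {v} (v∈A₀ , v∈B) with us , us∈ , v≡ ← ∈⨁⇒Vsum (A ∘ suc) v∈B = begin
      v            ≡⟨ +ᵥ-identityʳ v ⟨
      v +ᵥ 0ᵥ      ≡⟨ cong (v +ᵥ_) (direct (-ᵥ v ◂ us) (λ { zero → -ᵥ∈ A₀ v∈A₀ ; (suc i) → us∈ i })
                                    (trans (cong (-ᵥ v +ᵥ_) (sym v≡)) (trans (+ᵥ-comm _ v) (+ᵥ-inverseʳ v))) zero) ⟨
      v +ᵥ -ᵥ v    ≡⟨ +ᵥ-inverseʳ v ⟩
      0ᵥ           ∎
    direct-tail : ∀ us → (∀ i → us i ∈ A (suc i)) → Vsum F us ≡ 0ᵥ → ∀ i → us i ≡ 0ᵥ
    direct-tail us us∈ eq i = direct (0ᵥ ◂ us) (λ { zero → 0ᵥ∈ A₀ ; (suc i) → us∈ i })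
      (trans (+ᵥ-identityˡ _) eq) (suc i)

  -- Summands outside `I` are replaced by the trivial space, so that decompositions for different
  -- `I` share the index type `Fin t` and can be compared term by term.
  ⨁[_] : ∀ {t} → (Fin t → Bool) → (Fin t → Sub) → Sub
  ⨁[ I ] A = ⨁ (λ i → if I i then A i else trivial)

  mask-⊑ : ∀ b A → (if b then A else trivial) ⊑ A
  mask-⊑ true A v∈ = v∈
  mask-⊑ false A = trivial-⊑ A

  ⊑-⨁[] : ∀ {t} (I : Fin t → Bool) (A : Fin t → Sub) {i} → I i ≡ true → A i ⊑ ⨁[ I ] A
  ⊑-⨁[] I A {i} i∈I {v} v∈ = ⊑-⨁ _ i (subst (λ b → v ∈ (if b then A i else trivial)) (sym i∈I) v∈)

  ⨁[]-least : ∀ {t} (I : Fin t → Bool) (A : Fin t → Sub) (C : Sub) →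
              (∀ i → I i ≡ true → A i ⊑ C) → ⨁[ I ] A ⊑ C
  ⨁[]-least I A C A⊑C = ⨁-least _ C masked
    where
    masked : ∀ i → (if I i then A i else trivial) ⊑ C
    masked i with I i in eq
    ... | true = A⊑C i eq
    ... | false = trivial-⊑ C

  ⨁[]-mono : ∀ {t} {I J : Fin t → Bool} (A : Fin t → Sub) → (∀ i → I i ≡ true → J i ≡ true) →
             ⨁[ I ] A ⊑ ⨁[ J ] A
  ⨁[]-mono {I = I} {J} A I⊆J = ⨁[]-least I A (⨁[ J ] A) (λ i i∈I → ⊑-⨁[] J A (I⊆J i i∈I))

  dim-⨁[] : ∀ {t} (I : Fin t → Bool) (A : Fin t → Sub) →
    (∀ us → (∀ i → us i ∈ A i) → Vsum F us ≡ 0ᵥ → ∀ i → us i ≡ 0ᵥ) →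
    dim (⨁[ I ] A) ≡ sumOn I (dim ∘ A)
  dim-⨁[] I A direct = trans
    (dim-⨁ _ (λ us us∈ → direct us (λ i → mask-⊑ (I i) (A i) (us∈ i))))
    (sumFin-cong (λ i → dim-mask (I i) (A i)))
    where
    dim-mask : ∀ b A → dim (if b then A else trivial) ≡ (if b then dim A else 0)
    dim-mask true A = refl
    dim-mask false A = dim-trivial {trivial} id

-- Families supported at one index.

module Single (F : FiniteField) {k : ℕ} where

  open VectorSpace F

  single : ∀ {t} → Fin t → V F k → Fin t → V F k
  single zero v = v ◂ λ _ → 0ᵥ
  single (suc j) v = 0ᵥ ◂ single j v

  single-diagonal : ∀ {t} (j : Fin t) v → single j v j ≡ v
  single-diagonal zero v = refl
  single-diagonal (suc j) v = single-diagonal j v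

  Vsum-0 : ∀ t → Vsum F {k} {t} (λ _ → 0ᵥ) ≡ 0ᵥ
  Vsum-0 zero = refl
  Vsum-0 (suc t) = trans (+ᵥ-identityˡ _) (Vsum-0 t)

  Vsum-single : ∀ {t} (j : Fin t) v → Vsum F (single j v) ≡ v
  Vsum-single {suc t} zero v = trans (cong (v +ᵥ_) (Vsum-0 t)) (+ᵥ-identityʳ v)
  Vsum-single (suc j) v = trans (+ᵥ-identityˡ _) (Vsum-single j v)

  single∈ : ∀ {t} (W : Fin t → Pred (V F k) 0ℓ) → (∀ i → W i 0ᵥ) → ∀ j {v} → W j v →
            ∀ i → W i (single j v i)
  single∈ W 0∈W zero v∈ zero = v∈
  single∈ W 0∈W zero v∈ (suc i) = 0∈W (suc i)
  single∈ W 0∈W (suc j) v∈ zero = 0∈W zero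
  single∈ W 0∈W (suc j) v∈ (suc i) = single∈ (W ∘ suc) (0∈W ∘ suc) j v∈ i

-- Defect comparisons as inequalities between natural numbers.

diff-< : ∀ a b c d → a + d < c + b → ι a - ι b <ℤ ι c - ι d
diff-< a b c d lt = begin-strict
  ι a - ι b      ≡⟨ ℤ.m-n≡m⊖n a b ⟩
  a ⊖ b              ≡⟨ ℤ.+-cancelˡ-⊖ d a b ⟨
  (d + a) ⊖ (d + b)  <⟨ ℤ.⊖-monoˡ-< (d + b) (subst₂ _<_ (+-comm a d) (+-comm c b) lt) ⟩
  (b + c) ⊖ (d + b)  ≡⟨ cong ((b + c) ⊖_) (+-comm d b) ⟩
  (b + c) ⊖ (b + d)  ≡⟨ ℤ.+-cancelˡ-⊖ b c d ⟩
  c ⊖ d              ≡⟨ ℤ.m-n≡m⊖n c d ⟨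
  ι c - ι d      ∎
  where open ℤ.≤-Reasoning

diff-≤ : ∀ a b c d → a + d ≤ c + b → ι a - ι b ≤ℤ ι c - ι d
diff-≤ a b c d le = begin
  ι a - ι b      ≡⟨ ℤ.m-n≡m⊖n a b ⟩
  a ⊖ b              ≡⟨ ℤ.+-cancelˡ-⊖ d a b ⟨
  (d + a) ⊖ (d + b)  ≤⟨ ℤ.⊖-monoˡ-≤ (d + b) (subst₂ _≤_ (+-comm a d) (+-comm c b) le) ⟩
  (b + c) ⊖ (d + b)  ≡⟨ cong ((b + c) ⊖_) (+-comm d b) ⟩
  (b + c) ⊖ (b + d)  ≡⟨ ℤ.+-cancelˡ-⊖ b c d ⟩
  c ⊖ d              ≡⟨ ℤ.m-n≡m⊖n c d ⟨
  ι c - ι d      ∎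
  where open ℤ.≤-Reasoning

diff-<⁻ : ∀ a b c d → ι a - ι b <ℤ ι c - ι d → a + d < c + b
diff-<⁻ a b c d lt = ≰⇒> λ ge → ℤ.<⇒≱ lt (diff-≤ c d a b ge)

AllScalars-subfield : ∀ F → IsSubfield F (AllScalars F)
AllScalars-subfield F = _

-- Arithmetic of one induction step in `defect-≤`: the first premise is the gain in weight from `T`
-- to `T′`, the second the induction hypothesis for `T′`, whose dimension is `suc d`. The
-- contributions of `D` cancel.
cancel-step : ∀ {w kI nI d w′ kD nD} → w + suc nD ≤ w′ + kD →
              w′ + (kI + kD) ≤ (nI + nD) + suc d → w + kI ≤ nI + d
cancel-step {w} {kI} {nI} {d} {w′} {kD} {nD} p q = +-cancelʳ-≤ (suc nD) _ _ (begin
  (w + kI) + suc nD     ≡⟨ e₁ w kI nD ⟩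
  (w + suc nD) + kI     ≤⟨ +-monoˡ-≤ kI p ⟩
  (w′ + kD) + kI        ≡⟨ e₂ w′ kD kI ⟩
  w′ + (kI + kD)        ≤⟨ q ⟩
  (nI + nD) + suc d     ≡⟨ e₃ nI nD d ⟩
  (nI + d) + suc nD     ∎)
  where
  open ≤-Reasoning
  e₁ : ∀ x y z → (x + y) + suc z ≡ (x + suc z) + y
  e₁ = ℕ-Solver.solve-∀
  e₂ : ∀ x y z → (x + y) + z ≡ x + (z + y)
  e₂ = ℕ-Solver.solve-∀
  e₃ : ∀ x y z → (x + y) + suc z ≡ (x + z) + suc y
  e₃ = ℕ-Solver.solve-∀

-- Weights and dimensions of sums of components.

module Decomposition
  (F : FiniteField) {K : Pred (Carrier F) 0ℓ} (K-subfield : IsSubfield F K) (K? : Decidable K)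
  {t : ℕ} {kv nv : Fin t → ℕ} (kv<nv : ∀ i → kv i < nv i) {k : ℕ} (k≡Σkv : k ≡ sumFin kv)
  {U : Pred (V F k) 0ℓ} {Us : Fin t → Pred (V F k) 0ℓ}
  (U-subspace : IsSubspace F K U) (decomposable : Decomposable F K kv nv U Us) where

  open VectorSpace F
  open Single F {k}
  module LF = LinearAlgebra F {AllScalars F} (AllScalars-subfield F) (λ _ → yes tt) {k}
  module LK = LinearAlgebra F K-subfield K? {k}

  U⇔Vsum = proj₁ (proj₁ (proj₂ decomposable))
  Us-dim = proj₁ (proj₂ (proj₂ decomposable))
  V⇔Vsum = proj₁ (proj₁ (proj₂ (proj₂ (proj₂ decomposable))))
  Fcomp-unique = proj₂ (proj₁ (proj₂ (proj₂ (proj₂ decomposable))))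
  Fcomp-dim = proj₂ (proj₂ (proj₂ (proj₂ decomposable)))

  -- The same set of vectors over the smaller field, so that it can be intersected with `𝑈`.
  restrict : LF.Sub → LK.Sub
  restrict T = record
    { Contains = Contains T
    ; isSubspace = record { has-0 = LF.0ᵥ∈ T ; ⊕-closed = LF.+ᵥ∈ T ; ·-closed = λ _ → LF.*ᵥ∈ T tt }
    ; contains? = contains? T }

  𝑈ᵢ : Fin t → LK.Sub
  𝑈ᵢ i = LK.hasDim⇒subspace (Us-dim i)

  𝐹ᵢ : Fin t → LF.Sub
  𝐹ᵢ i = LF.hasDim⇒subspace (Fcomp-dim i)

  𝑈 : LK.Sub
  𝑈 = record
    { Contains = U ; isSubspace = U-subspace
    ; contains? = λ v → map′ (proj₂ (U⇔Vsum v) ∘ LK.∈⨁⇒Vsum 𝑈ᵢ)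
        (λ Uv → let (us , us∈ , v≡) = proj₁ (U⇔Vsum v) Uv in
                subst (_∈ LK.⨁ 𝑈ᵢ) (sym v≡) (LK.Vsum∈⨁ 𝑈ᵢ us∈))
        (contains? (LK.⨁ 𝑈ᵢ) v) }

  𝐹⟨_⟩ : (Fin t → Bool) → LF.Sub
  𝐹⟨ I ⟩ = LF.⨁[ I ] 𝐹ᵢ

  weight : LF.Sub → ℕ
  weight T = LK.dim (𝑈 LK.⊓ restrict T)

  weight-mono : ∀ {T T′} → T ⊑ T′ → weight T ≤ weight T′
  weight-mono {T} {T′} T⊑T′ = LK.dim-mono {𝑈 LK.⊓ restrict T} {𝑈 LK.⊓ restrict T′}
    (λ (Uv , v∈T) → Uv , T⊑T′ v∈T)

  weight-adjoin : ∀ T {u} → U u → u ∉ T → weight T < weight (LF.adjoin T u)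
  weight-adjoin T {u} Uu u∉T =
    LK.dim-strict {𝑈 LK.⊓ restrict T} {𝑈 LK.⊓ restrict (LF.adjoin T u)}
    (λ (Uv , v∈T) → Uv , LF.⊑-adjoin T u v∈T) (Uu , LF.∈-adjoin T u) (u∉T ∘ proj₂)

  Us⊑Fcomp : ∀ i → 𝑈ᵢ i ⊑ 𝐹ᵢ i
  Us⊑Fcomp i {v} v∈ = 1 , (λ _ → v) , (λ _ → v∈) , (λ _ → 1ᶠ F) , (λ _ → tt) ,
    sym (trans (+ᵥ-identityʳ _) (*ᵥ-identityˡ v))

  Fcomp-least : ∀ i (C : LF.Sub) → 𝑈ᵢ i ⊑ C → 𝐹ᵢ i ⊑ C
  Fcomp-least i C U⊑C (_ , vs , vs∈ , cs , _ , refl) =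
    LF.lincomb∈ C {cs = cs} (λ _ → tt) (λ j → U⊑C (vs∈ j))

  Us⊑U : ∀ i → 𝑈ᵢ i ⊑ 𝑈
  Us⊑U i {v} v∈ = proj₂ (U⇔Vsum v)
    (single i v , single∈ Us (λ j → LK.0ᵥ∈ (𝑈ᵢ j)) i v∈ , sym (Vsum-single i v))

  Fcomp-direct : ∀ us → (∀ i → us i ∈ 𝐹ᵢ i) → Vsum F us ≡ 0ᵥ → ∀ i → us i ≡ 0ᵥ
  Fcomp-direct us us∈ eq = Fcomp-unique us (λ _ → 0ᵥ) us∈ (λ i → LF.0ᵥ∈ (𝐹ᵢ i)) (trans eq (sym (Vsum-0 t)))

  dim-𝐹⟨⟩ : ∀ I → LF.dim 𝐹⟨ I ⟩ ≡ sumOn I kv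
  dim-𝐹⟨⟩ I = trans (LF.dim-⨁[] I 𝐹ᵢ Fcomp-direct)
    (sumOn-cong I (λ i → LF.hasDim⇒dim (𝐹ᵢ i) (Fcomp-dim i)))

  -- Such a vector decomposes both through the `Us` and through the `𝐹ᵢ` with index in `I`.
  -- Directness of the `𝐹ᵢ` identifies the two, so the terms outside `I` vanish.
  U∩𝐹⟨⟩ : ∀ I → 𝑈 LK.⊓ restrict 𝐹⟨ I ⟩ ⊑ LK.⨁[ I ] 𝑈ᵢ
  U∩𝐹⟨⟩ I {v} (Uv , v∈F) with proj₁ (U⇔Vsum v) Uv | LF.∈⨁⇒Vsum _ v∈F
  ... | us , us∈ , refl | fs , fs∈ , v≡ = LK.Vsum∈⨁ _ masked
    where
    us≡fs : ∀ i → us i ≡ fs i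
    us≡fs = Fcomp-unique us fs (λ i → Us⊑Fcomp i (us∈ i)) (λ i → LF.mask-⊑ (I i) (𝐹ᵢ i) (fs∈ i)) v≡
    masked : ∀ i → us i ∈ (if I i then 𝑈ᵢ i else LK.trivial)
    masked i with I i | fs∈ i
    ... | true | _ = us∈ i
    ... | false | fs≡0 = trans (us≡fs i) fs≡0

  𝑈⟨⟩⊑ : ∀ I → LK.⨁[ I ] 𝑈ᵢ ⊑ 𝑈 LK.⊓ restrict 𝐹⟨ I ⟩
  𝑈⟨⟩⊑ I = LK.⨁[]-least I 𝑈ᵢ (𝑈 LK.⊓ restrict 𝐹⟨ I ⟩)
    (λ i i∈I v∈ → Us⊑U i v∈ , LF.⊑-⨁[] I 𝐹ᵢ i∈I (Us⊑Fcomp i v∈))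

  weight-𝐹⟨⟩ : ∀ I → weight 𝐹⟨ I ⟩ ≡ sumOn I nv
  weight-𝐹⟨⟩ I = begin
    weight 𝐹⟨ I ⟩          ≡⟨ LK.dim-cong {𝑈 LK.⊓ restrict 𝐹⟨ I ⟩} {LK.⨁[ I ] 𝑈ᵢ} (U∩𝐹⟨⟩ I) (𝑈⟨⟩⊑ I) ⟩
    LK.dim (LK.⨁[ I ] 𝑈ᵢ)  ≡⟨ LK.dim-⨁[] I 𝑈ᵢ (λ us us∈ → Fcomp-direct us (λ i → Us⊑Fcomp i (us∈ i))) ⟩
    sumOn I (LK.dim ∘ 𝑈ᵢ)  ≡⟨ sumOn-cong I (λ i → LK.hasDim⇒dim (𝑈ᵢ i) (Us-dim i)) ⟩
    sumOn I nv             ∎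
    where open ≡-Reasoning

  -- Presents the whole space as a partial sum, so that its dimension is an instance of `dim-𝐹⟨⟩`.
  everything : Fin t → Bool
  everything _ = true

  ∈-everything : ∀ v → v ∈ 𝐹⟨ everything ⟩
  ∈-everything v with us , us∈ , refl ← proj₁ (V⇔Vsum v) tt = LF.Vsum∈⨁ 𝐹ᵢ us∈

  dim-everything : LF.dim 𝐹⟨ everything ⟩ ≡ k
  dim-everything = trans (dim-𝐹⟨⟩ everything) (sym k≡Σkv)

  dim<k : ∀ T {v} → v ∉ T → LF.dim T < k
  dim<k T {v} v∉T = subst (LF.dim T <_) dim-everything
    (LF.dim-strict {T} {𝐹⟨ everything ⟩} (λ {u} _ → ∈-everything u) (∈-everything v) v∉T)

  U-spans : ∀ T → 𝑈 ⊑ T → ∀ v → v ∈ T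
  U-spans T U⊑T v = LF.⨁[]-least everything 𝐹ᵢ T
    (λ i _ → Fcomp-least i T (λ u∈ → U⊑T (Us⊑U i u∈))) (∈-everything v)

  nonzero : ∀ i → ∃ λ u → u ∈ 𝑈ᵢ i × u ≢ 0ᵥ
  nonzero i with ⊑-or-witness (𝑈ᵢ i) LK.trivial
  ... | inj₂ w = w
  ... | inj₁ U⊑0 = ⊥-elim (n≮0 (subst (kv i <_) nv≡0 (kv<nv i)))
    where
    nv≡0 : nv i ≡ 0
    nv≡0 = trans (sym (LK.hasDim⇒dim (𝑈ᵢ i) (Us-dim i))) (LK.dim-trivial {𝑈ᵢ i} U⊑0)

  disjoint : ∀ I {j} → I j ≡ false → ∀ {v} → v ∈ 𝐹ᵢ j → v ∈ 𝐹⟨ I ⟩ → v ≡ 0ᵥ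
  disjoint I {j} j∉I {v} v∈Fj v∈FI with fs , fs∈ , v≡ ← LF.∈⨁⇒Vsum _ v∈FI = begin
    v             ≡⟨ single-diagonal j v ⟨
    single j v j  ≡⟨ Fcomp-unique (single j v) fs (single∈ (λ i → Contains (𝐹ᵢ i)) (λ i → LF.0ᵥ∈ (𝐹ᵢ i)) j v∈Fj)
                       (λ i → LF.mask-⊑ (I i) (𝐹ᵢ i) (fs∈ i)) (trans (Vsum-single j v) v≡) j ⟩
    fs j          ≡⟨ subst (λ b → fs j ∈ (if b then 𝐹ᵢ j else LF.trivial)) j∉I (fs∈ j) ⟩
    0ᵥ            ∎
    where open ≡-Reasoning

  -- For `j` outside `I`, directness would kill the nonzero vector of `𝑈ᵢ j`, which exists because
  -- `kv j < nv j`.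
  𝐹ᵢ⊑𝐹⟨⟩ : ∀ I {j} → 𝐹ᵢ j ⊑ 𝐹⟨ I ⟩ → I j ≡ true
  𝐹ᵢ⊑𝐹⟨⟩ I {j} Fj⊑ with I j in eq
  ... | true = refl
  ... | false with u , u∈ , u≢0 ← nonzero j =
    ⊥-elim (u≢0 (disjoint I eq (Us⊑Fcomp j u∈) (Fj⊑ (Us⊑Fcomp j u∈))))

  -- Scattered hyperplanes and the bound on the defect.

  ScatteredHyperplanes : Set₁
  ScatteredHyperplanes = ∀ H → suc (LF.dim H) ≡ k → (∀ i → ¬ 𝐹ᵢ i ⊑ H) → weight H ≤ LF.dim H

  -- The set `I(T)`, Boolean-valued so that it can index `𝐹⟨_⟩` and `sumOn` directly.
  components : LF.Sub → Fin t → Bool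
  components T i = does (⊑-dec (𝐹ᵢ i) T)

  components⁻ : ∀ T i → components T i ≡ true → 𝐹ᵢ i ⊑ T
  components⁻ T i eq with ⊑-dec (𝐹ᵢ i) T
  ... | yes Fi⊑T = Fi⊑T

  components⁺ : ∀ T i → 𝐹ᵢ i ⊑ T → components T i ≡ true
  components⁺ T i Fi⊑T = dec-true (⊑-dec (𝐹ᵢ i) T) Fi⊑T

  𝐹⟨components⟩⊑ : ∀ T → 𝐹⟨ components T ⟩ ⊑ T
  𝐹⟨components⟩⊑ T = LF.⨁[]-least (components T) 𝐹ᵢ T (components⁻ T)

  module _ (scattered : ScatteredHyperplanes) where

    -- A hyperplane H of 𝐹⟨ D ⟩ of positive defect would extend to one of the whole space.  Fix
    -- a ∈ U ∩ 𝐹⟨ D ⟩ outside H and nonzero uⱼ ∈ Uⱼ.  Adjoining to H all uⱼ + a with j ∉ D and then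
    -- further vectors of U never lowers the defect, and as long as a is avoided the result cannot
    -- contain any Fᵢ.
    scattered-on : ∀ D H → H ⊑ 𝐹⟨ D ⟩ → suc (LF.dim H) ≡ LF.dim 𝐹⟨ D ⟩ →
                   (∀ i → D i ≡ true → ¬ 𝐹ᵢ i ⊑ H) → weight H ≤ LF.dim H
    scattered-on D H H⊑F dim-H no-F with ⊑-or-witness (LK.⨁[ D ] 𝑈ᵢ) H
    -- If `H` contained all `𝑈ᵢ i` with `i` in `D`, it would contain `𝐹⟨ D ⟩`, against the
    -- dimensions. The witness of the other case is `a`.
    ... | inj₁ UD⊑H = ⊥-elim (1+n≰n (subst (_≤ LF.dim H) (sym dim-H) (LF.dim-mono {𝐹⟨ D ⟩} {H}
            (LF.⨁[]-least D 𝐹ᵢ H (λ i i∈D → Fcomp-least i H (λ v∈ → UD⊑H (LK.⊑-⨁[] D 𝑈ᵢ i∈D v∈)))))))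
    ... | inj₂ (a , a∈UD , a∉H) = ≮⇒≥ λ pos →
            build (allFin t) D H (λ _ → id) H⊑F id a∉H pos
              (λ j j∉D j∈D → case trans (sym j∉D) j∈D of λ ()) (λ i → inj₂ (∈-allFin i))
      where
      Ua : U a
      Ua = proj₁ (𝑈⟨⟩⊑ D a∈UD)

      a∈F : a ∈ 𝐹⟨ D ⟩
      a∈F = proj₂ (𝑈⟨⟩⊑ D a∈UD)

      u : Fin t → V F k
      u j = proj₁ (nonzero j)

      Uu : ∀ j → U (u j)
      Uu j = Us⊑U j (proj₁ (proj₂ (nonzero j)))

      u∈F : ∀ j → u j ∈ 𝐹ᵢ j
      u∈F j = Us⊑Fcomp j (proj₁ (proj₂ (nonzero j)))

      F⊑H+a : 𝐹⟨ D ⟩ ⊑ LF.adjoin H a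
      F⊑H+a = LF.dim-full {LF.adjoin H a} {𝐹⟨ D ⟩} (LF.adjoin-least H a 𝐹⟨ D ⟩ H⊑F a∈F)
        (≤-reflexive (trans (sym dim-H) (sym (LF.dim-adjoin-∉ H a∉H))))

      -- The dimension grows by exactly one, the weight by at least one.
      pos-adjoin : ∀ T {v} → U v → v ∉ T → LF.dim T < weight T →
                   LF.dim (LF.adjoin T v) < weight (LF.adjoin T v)
      pos-adjoin T {v} Uv v∉T pos =
        subst (_< weight (LF.adjoin T v)) (sym (LF.dim-adjoin-∉ T v∉T))
          (≤-<-trans pos (weight-adjoin T Uv v∉T))

      -- Induction on the bound `n` for the codimension of `T`, until `T` is a hyperplane that
      -- contradicts `scattered`.
      finish : ∀ n T → H ⊑ T → a ∉ T → LF.dim T < weight T →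
               (∀ j → D j ≡ false → u j +ᵥ a ∈ T) → k ≤ n + LF.dim T → ⊥
      finish zero T H⊑T a∉T pos u+a∈T k≤ = <⇒≱ (dim<k T a∉T) k≤
      -- The test is against `T` with `a` adjoined: a vector of `U` outside it can join `T` without
      -- bringing in `a`, by exchange. If there is none, adjoining `a` already gives the whole
      -- space.
      finish (suc n) T H⊑T a∉T pos u+a∈T k≤ with ⊑-or-witness 𝑈 (LF.adjoin T a)
      ... | inj₂ (x , Ux , x∉T+a) =
        finish n (LF.adjoin T x) (λ v∈H → LF.⊑-adjoin T x (H⊑T v∈H))
          (λ a∈ → x∉T+a (LF.exchange T a∈ a∉T))
          (pos-adjoin T Ux x∉T pos)
          (λ j j∉D → LF.⊑-adjoin T x (u+a∈T j j∉D))
          (≤-trans k≤ (≤-reflexive (trans (sym (+-suc n _)) (cong (n +_) (sym (LF.dim-adjoin-∉ T x∉T))))))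
        where
        x∉T : x ∉ T
        x∉T x∈T = x∉T+a (LF.⊑-adjoin T a x∈T)
      ... | inj₁ U⊑T+a = <⇒≱ pos (scattered T hyperplane no-Fᵢ)
        where
        hyperplane : suc (LF.dim T) ≡ k
        hyperplane = trans (sym (LF.dim-adjoin-∉ T a∉T)) (trans
          (LF.dim-cong {LF.adjoin T a} {𝐹⟨ everything ⟩}
            (λ {v} _ → ∈-everything v) (λ {v} _ → U-spans (LF.adjoin T a) U⊑T+a v))
          dim-everything)
        -- For `i` outside `D`, both `u i` and `u i +ᵥ a` would be in `T`, hence `a` too. For `i` in
        -- `D`, a vector of `𝐹ᵢ i` is `h +ᵥ c *ᵥ a` with `h` in `H`; as `a` avoids `T`, `c` is zero,
        -- so `𝐹ᵢ i` would lie in `H`.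
        no-Fᵢ : ∀ i → ¬ 𝐹ᵢ i ⊑ T
        no-Fᵢ i Fi⊑T with D i in eq
        ... | false = a∉T (LF.cancelˡ∈ T a (u+a∈T i eq) (Fi⊑T (u∈F i)))
        ... | true = no-F i eq Fi⊑H
          where
          Fi⊑H : 𝐹ᵢ i ⊑ H
          Fi⊑H {f} f∈ with F⊑H+a (LF.⊑-⨁[] D 𝐹ᵢ eq f∈)
          ... | c , _ , h , h∈H , refl with c ≟ᶠ 0ᶠ F
          ...   | yes refl = subst (_∈ H) (sym (trans (cong (h +ᵥ_) (*ᵥ-zeroˡ a)) (+ᵥ-identityʳ h))) h∈H
          ...   | no c≢0 = ⊥-elim (a∉T (LF.unscale∈ T tt c≢0
                             (LF.cancelˡ∈ T (c *ᵥ a) (Fi⊑T f∈) (H⊑T h∈H))))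

      -- `E` holds the indices treated so far. For `j` outside `E`, directness puts `u j +ᵥ a`
      -- outside `𝐹⟨ E ⟩`. Adjoining it cannot bring in `a`: by exchange it would lie in the span of
      -- `T` and `a`, which is inside `𝐹⟨ E ⟩`.
      build : ∀ js (E : Fin t → Bool) T → (∀ j → D j ≡ true → E j ≡ true) → T ⊑ 𝐹⟨ E ⟩ →
              H ⊑ T → a ∉ T → LF.dim T < weight T →
              (∀ j → D j ≡ false → E j ≡ true → u j +ᵥ a ∈ T) →
              (∀ i → E i ≡ true ⊎ i ∈ₗ js) → ⊥
      build [] E T D⊆E T⊑F H⊑T a∉T pos u+a∈T todo = finish k T H⊑T a∉T pos
        (λ j j∉D → u+a∈T j j∉D (case todo j of λ { (inj₁ j∈E) → j∈E })) (m≤m+n k _)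
      build (j ∷ js) E T D⊆E T⊑F H⊑T a∉T pos u+a∈T todo with E j in eq
      ... | true = build js E T D⊆E T⊑F H⊑T a∉T pos u+a∈T
        (λ i → case todo i of λ
          { (inj₁ i∈E) → inj₁ i∈E ; (inj₂ (here refl)) → inj₁ eq ; (inj₂ (there i∈js)) → inj₂ i∈js })
      ... | false = build js E′ (LF.adjoin T x) (λ i → E⊆E′ i ∘ D⊆E i)
        (LF.adjoin-least T x 𝐹⟨ E′ ⟩ (λ v∈ → F⊑F′ (T⊑F v∈)) (LF.+ᵥ∈ 𝐹⟨ E′ ⟩
          (LF.⊑-⨁[] E′ 𝐹ᵢ j∈E′ (u∈F j)) (F⊑F′ a∈FE)))
        (λ v∈H → LF.⊑-adjoin T x (H⊑T v∈H))
        (λ a∈ → x∉F (LF.adjoin-least T a 𝐹⟨ E ⟩ T⊑F a∈FE (LF.exchange T a∈ a∉T)))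
        (pos-adjoin T (LK.+ᵥ∈ 𝑈 (Uu j) Ua) (λ x∈T → x∉F (T⊑F x∈T)) pos)
        u+a∈T′
        (λ i → case todo i of λ
          { (inj₁ i∈E) → inj₁ (E⊆E′ i i∈E) ; (inj₂ (here refl)) → inj₁ j∈E′ ; (inj₂ (there i∈js)) → inj₂ i∈js })
        where
        x : V F k
        x = u j +ᵥ a

        E′ : Fin t → Bool
        E′ i = E i ∨ does (i Fin.≟ j)

        E⊆E′ : ∀ i → E i ≡ true → E′ i ≡ true
        E⊆E′ i i∈E rewrite i∈E = refl

        j∈E′ : E′ j ≡ true
        j∈E′ = trans (cong (E j ∨_) (dec-true (j Fin.≟ j) refl)) (Bool.∨-zeroʳ (E j))

        F⊑F′ : 𝐹⟨ E ⟩ ⊑ 𝐹⟨ E′ ⟩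
        F⊑F′ = LF.⨁[]-mono {I = E} {E′} 𝐹ᵢ E⊆E′

        a∈FE : a ∈ 𝐹⟨ E ⟩
        a∈FE = LF.⨁[]-mono {I = D} {E} 𝐹ᵢ D⊆E a∈F

        x∉F : x ∉ 𝐹⟨ E ⟩
        x∉F x∈ = proj₂ (proj₂ (nonzero j))
          (disjoint E eq (u∈F j) (LF.cancelʳ∈ 𝐹⟨ E ⟩ (u j) x∈ a∈FE))

        u+a∈T′ : ∀ i → D i ≡ false → E′ i ≡ true → u i +ᵥ a ∈ LF.adjoin T x
        u+a∈T′ i i∉D i∈E′ with i Fin.≟ j
        ... | yes refl = LF.∈-adjoin T x
        ... | no _ = LF.⊑-adjoin T x (u+a∈T i i∉D (trans (sym (Bool.∨-identityʳ (E i))) i∈E′))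

    -- By `dim-𝐹⟨⟩` and `weight-𝐹⟨⟩` the two sums are the dimension and weight of
    -- `𝐹⟨ components T ⟩`; this is the comparison of defects with subtractions moved across.
    defect-≤ : ∀ T → weight T + sumOn (components T) kv ≤ sumOn (components T) nv + LF.dim T
    defect-≤ T = by-codimension k T (m≤m+n k _)
      where
      by-codimension : ∀ n T → k ≤ n + LF.dim T →
                       weight T + sumOn (components T) kv ≤ sumOn (components T) nv + LF.dim T
      by-codimension n T k≤ with ⊑-or-witness 𝑈 T
      -- A subspace containing `U` is the whole space, so every index belongs to `I`.
      by-codimension n T k≤ | inj₁ U⊑T = +-mono-≤
        (subst (weight T ≤_) (weight-𝐹⟨⟩ I) (weight-mono {T} {𝐹⟨ I ⟩} (λ {v} _ → all∈ v)))
        (subst (_≤ LF.dim T) (dim-𝐹⟨⟩ I) (LF.dim-mono {𝐹⟨ I ⟩} {T} (𝐹⟨components⟩⊑ T)))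
        where
        I = components T
        all∈ : ∀ v → v ∈ 𝐹⟨ I ⟩
        all∈ v = LF.⨁[]-mono {I = everything} {I} 𝐹ᵢ
          (λ i _ → components⁺ T i (λ {u} _ → U-spans T U⊑T u)) (∈-everything v)
      by-codimension zero T k≤ | inj₂ (x , Ux , x∉T) = ⊥-elim (<⇒≱ (dim<k T x∉T) k≤)
      by-codimension (suc n) T k≤ | inj₂ (x , Ux , x∉T) =
        cancel-step {weight T} {sumOn I kv} {sumOn I nv} {LF.dim T} {weight T′} {sumOn D kv} {sumOn D nv} gain
          (subst₂ _≤_ (cong (weight T′ +_) (sumOn-split I′ I kv I⊆I′))
                      (cong₂ _+_ (sumOn-split I′ I nv I⊆I′) dim-T′)
            (by-codimension n T′ (≤-trans k≤
              (≤-reflexive (trans (sym (+-suc n _)) (cong (n +_) (sym dim-T′)))))))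
        where
        T′ = LF.adjoin T x
        I = components T
        I′ = components T′
        D = I′ ∖ I

        dim-T′ : LF.dim T′ ≡ suc (LF.dim T)
        dim-T′ = LF.dim-adjoin-∉ T x∉T

        I⊆I′ : ∀ i → I i ≡ true → I′ i ≡ true
        I⊆I′ i i∈I = components⁺ T′ i (λ v∈ → LF.⊑-adjoin T x (components⁻ T i i∈I v∈))

        -- The weight grows by at least one more than the defect of `𝐹⟨ D ⟩`. The extra one pays for
        -- the dimension added by `x`.
        gain : weight T + suc (sumOn D nv) ≤ weight T′ + sumOn D kv
        gain with Fin.any? (λ i → D i Bool.≟ true)
        -- With `D` empty, the vector `x` alone supplies the growth.
        ... | no none = subst₂ _≤_
          (trans (+-comm 1 _) (cong (λ s → weight T + suc s) (sym (sumOn-empty D nv (λ i i∈D → none (i , i∈D))))))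
          (trans (sym (+-identityʳ _)) (cong (weight T′ +_) (sym (sumOn-empty D kv (λ i i∈D → none (i , i∈D))))))
          (weight-adjoin T Ux x∉T)
        ... | yes (i , i∈D) = begin
          weight T + suc (sumOn D nv)                     ≡⟨ +-suc (weight T) _ ⟩
          suc (weight T + sumOn D nv)                     ≡⟨ cong (λ s → suc (weight T + s)) (weight-𝐹⟨⟩ D) ⟨
          suc (weight T + weight G)                       ≡⟨ cong suc (LK.grassmann UT UG) ⟨
          suc (LK.dim (UT LK.⊞ UG) + LK.dim (UT LK.⊓ UG)) ≤⟨ s≤s (+-mono-≤
            (LK.dim-mono {UT LK.⊞ UG} {𝑈 LK.⊓ restrict T′}
              (LK.⊞-least UT UG (𝑈 LK.⊓ restrict T′)
                (λ (Uv , v∈T) → Uv , LF.⊑-adjoin T x v∈T) (λ (Uv , v∈G) → Uv , G⊑T′ v∈G)))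
            (≤-trans
              (LK.dim-mono {UT LK.⊓ UG} {𝑈 LK.⊓ restrict (T LF.⊓ G)}
                (λ ((Uv , v∈T) , (_ , v∈G)) → Uv , v∈T , v∈G))
              (scattered-on D (T LF.⊓ G) proj₂ hyperplane no-F))) ⟩
          suc (weight T′ + LF.dim (T LF.⊓ G))             ≡⟨ +-suc (weight T′) _ ⟨
          weight T′ + suc (LF.dim (T LF.⊓ G))             ≡⟨ cong (weight T′ +_) (trans hyperplane (dim-𝐹⟨⟩ D)) ⟩
          weight T′ + sumOn D kv                          ∎
          where
          open ≤-Reasoning
          G = 𝐹⟨ D ⟩
          UT = 𝑈 LK.⊓ restrict T
          UG = 𝑈 LK.⊓ restrict G

          no-F : ∀ i → D i ≡ true → ¬ 𝐹ᵢ i ⊑ T LF.⊓ G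
          no-F i i∈D Fi⊑ = case trans (sym (components⁺ T i (λ v∈ → proj₁ (Fi⊑ v∈)))) (proj₂ (∖-true I′ I i i∈D)) of λ ()

          G⊑T′ : G ⊑ T′
          G⊑T′ = LF.⨁[]-least D 𝐹ᵢ T′ (λ i i∈D → components⁻ T′ i (proj₁ (∖-true I′ I i i∈D)))

          T<T⊞G : LF.dim T < LF.dim (T LF.⊞ G)
          T<T⊞G = case ⊑-or-witness (𝐹ᵢ i) T of λ
            { (inj₁ Fi⊑T) → ⊥-elim (no-F i i∈D (λ v∈ → Fi⊑T v∈ , LF.⊑-⨁[] D 𝐹ᵢ i∈D v∈))
            ; (inj₂ (f , f∈ , f∉T)) → LF.dim-strict {T} {T LF.⊞ G} (LF.⊑-⊞ˡ T G)
                (LF.⊑-⊞ʳ T G (LF.⊑-⨁[] D 𝐹ᵢ i∈D f∈)) f∉T }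

          dim-T⊞G : LF.dim (T LF.⊞ G) ≡ suc (LF.dim T)
          dim-T⊞G = ≤-antisym
            (subst (LF.dim (T LF.⊞ G) ≤_) dim-T′ (LF.dim-mono {T LF.⊞ G} {T′}
              (LF.⊞-least T G T′ (LF.⊑-adjoin T x) G⊑T′)))
            T<T⊞G

          -- `T LF.⊞ G` lies strictly above `T` and inside `T′`, so its dimension is one more than
          -- that of `T`; Grassmann's formula transfers this codimension to `G`.
          hyperplane : suc (LF.dim (T LF.⊓ G)) ≡ LF.dim G
          hyperplane = +-cancelˡ-≡ (LF.dim T) _ _ (trans (+-suc (LF.dim T) _)
            (trans (cong (_+ LF.dim (T LF.⊓ G)) (sym dim-T⊞G)) (LF.grassmann T G)))

  -- Translation to `SumOver` and to integer defects.

  SumOver⇒𝐹⟨⟩ : ∀ I {v} → SumOver F I (Fcomp F K Us) v → v ∈ 𝐹⟨ Vec.lookup I ⟩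
  SumOver⇒𝐹⟨⟩ I (us , us∈ , refl) = LF.Vsum∈⨁ _ masked
    where
    masked : ∀ i → us i ∈ (if Vec.lookup I i then 𝐹ᵢ i else LF.trivial)
    masked i with Vec.lookup I i in eq
    ... | true = proj₁ (us∈ i) (Vec.lookup⇒[]= i I eq)
    ... | false = proj₂ (us∈ i) λ i∈I → case trans (sym eq) (Vec.[]=⇒lookup i∈I) of λ ()

  𝐹⟨⟩⇒SumOver : ∀ I {v} → v ∈ 𝐹⟨ Vec.lookup I ⟩ → SumOver F I (Fcomp F K Us) v
  𝐹⟨⟩⇒SumOver I v∈ with fs , fs∈ , v≡ ← LF.∈⨁⇒Vsum _ v∈ = fs , (λ i → present i , absent i) , v≡
    where
    present : ∀ i → _ → fs i ∈ 𝐹ᵢ i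
    present i _ = LF.mask-⊑ (Vec.lookup I i) (𝐹ᵢ i) (fs∈ i)
    absent : ∀ i → ¬ (I Vec.[ i ]= true) → fs i ≡ 0ᵥ
    absent i i∉I with Vec.lookup I i in eq | fs∈ i
    ... | true | _ = ⊥-elim (i∉I (Vec.lookup⇒[]= i I eq))
    ... | false | fs≡0 = fs≡0

  Characterisation : Pred (V F k) 0ℓ → Set₁
  Characterisation T =
    (PositiveDefect F K {k} {t} U T × MinimalDefect F K {k} {t} U T) ⇔
    Σ (Subset t) (λ I → Nonempty I × (∀ v → (T v → SumOver F I (Fcomp F K Us) v)
                                          × (SumOver F I (Fcomp F K Us) v → T v)))

  defect : ∀ T → Defect F K {k} {t} U (Contains T) (ι (weight T) - ι (LF.dim T))
  defect T = weight T , LF.dim T , LK.dim⇒hasDim (𝑈 LK.⊓ restrict T) , LF.dim⇒hasDim T , refl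

  defect-unique : ∀ T {e} → Defect F K {k} {t} U (Contains T) e → e ≡ ι (weight T) - ι (LF.dim T)
  defect-unique T (w , b , w-dim , b-dim , refl) = cong₂ (λ w b → ι w - ι b)
    (sym (LK.hasDim⇒dim (𝑈 LK.⊓ restrict T) w-dim)) (sym (LF.hasDim⇒dim T b-dim))

  positive : ∀ T → LF.dim T < weight T → PositiveDefect F K {k} {t} U (Contains T)
  positive T pos = _ , defect T , diff-< 0 0 (weight T) (LF.dim T) (subst (LF.dim T <_) (sym (+-identityʳ _)) pos)

  positive⁻ : ∀ T → PositiveDefect F K {k} {t} U (Contains T) → LF.dim T < weight T
  positive⁻ T (e , e-def , e>0) = subst (LF.dim T <_) (+-identityʳ _)
    (diff-<⁻ 0 0 (weight T) (LF.dim T) (subst (ι 0 <ℤ_) (defect-unique T e-def) e>0))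

  -- A subspace that has a defect comes with a basis, hence with decidable membership, so testing
  -- bundled subspaces suffices.
  minimal : ∀ T → (∀ T′ → T′ ⊑ T → (∃ λ v → v ∈ T × v ∉ T′) →
                     weight T′ + LF.dim T < weight T + LF.dim T′) →
            MinimalDefect F K {k} {t} U (Contains T)
  minimal T proper T′ _ T′⊆T v e′ e e′-def@(_ , _ , _ , T′-dim , _) e-def =
    subst₂ _<ℤ_ (sym (defect-unique 𝑇′ e′-def)) (sym (defect-unique T e-def))
      (diff-< (weight 𝑇′) (LF.dim 𝑇′) (weight T) (LF.dim T) (proper 𝑇′ T′⊆T v))
    where 𝑇′ = LF.hasDim⇒subspace T′-dim

  -- From scattered hyperplanes to the classification of minimal subspaces.

  module _ (scattered : ScatteredHyperplanes) where

    -- If `𝐹⟨ I ⟩` were proper in `T`, minimality would contradict `defect-≤`. If `I` were empty,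
    -- `defect-≤` would make the defect nonpositive.
    minimal⇒sum : ∀ T → PositiveDefect F K {k} {t} U (Contains T) → MinimalDefect F K {k} {t} U (Contains T) →
      Σ (Subset t) λ I → Nonempty I × (∀ v → (v ∈ T → SumOver F I (Fcomp F K Us) v)
                                            × (SumOver F I (Fcomp F K Us) v → v ∈ T))
    minimal⇒sum T pos min = Vec.tabulate I , nonempty , λ v →
        (λ v∈T → 𝐹⟨⟩⇒SumOver (Vec.tabulate I) (LF.⨁[]-mono {I = I} {Vec.lookup (Vec.tabulate I)} 𝐹ᵢ
                    (λ i i∈I → trans (Vec.lookup∘tabulate I i) i∈I) (T⊑ v∈T)))
      , (λ v∈ → 𝐹⟨components⟩⊑ T (LF.⨁[]-mono {I = Vec.lookup (Vec.tabulate I)} {I} 𝐹ᵢ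
                    (λ i i∈I → trans (sym (Vec.lookup∘tabulate I i)) i∈I) (SumOver⇒𝐹⟨⟩ (Vec.tabulate I) v∈)))
      where
      I = components T

      nonempty : Nonempty (Vec.tabulate I)
      nonempty with Fin.any? (λ i → I i Bool.≟ true)
      ... | yes (i , i∈I) = i , Vec.lookup⇒[]= i _ (trans (Vec.lookup∘tabulate I i) i∈I)
      ... | no none = ⊥-elim (<⇒≱ (positive⁻ T pos) (subst₂ _≤_
              (trans (cong (weight T +_) (sumOn-empty I kv empty)) (+-identityʳ _))
              (cong (_+ LF.dim T) (sumOn-empty I nv empty)) (defect-≤ scattered T)))
        where
        empty : ∀ i → I i ≢ true
        empty i i∈I = none (i , i∈I)

      T⊑ : T ⊑ 𝐹⟨ I ⟩
      T⊑ {v} v∈T = decidable-stable (contains? 𝐹⟨ I ⟩ v) λ v∉ → <⇒≱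
        (diff-<⁻ (weight 𝐹⟨ I ⟩) (LF.dim 𝐹⟨ I ⟩) (weight T) (LF.dim T)
          (min (Contains 𝐹⟨ I ⟩) (isSubspace 𝐹⟨ I ⟩) (𝐹⟨components⟩⊑ T) (v , v∈T , v∉) _ _
            (defect 𝐹⟨ I ⟩) (defect T)))
        (subst₂ _≤_ (cong (weight T +_) (sym (dim-𝐹⟨⟩ I))) (cong (_+ LF.dim T) (sym (weight-𝐹⟨⟩ I)))
          (defect-≤ scattered T))

    -- A proper subspace `T′` misses some component with index in `I`. Its defect is at most that of
    -- the sum over `components T′`, and the missed indices make this strictly less than that of
    -- `T`.
    sum⇒minimal : ∀ T I → (∃ λ i → I i ≡ true) → T ⊑ 𝐹⟨ I ⟩ → 𝐹⟨ I ⟩ ⊑ T →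
      PositiveDefect F K {k} {t} U (Contains T) × MinimalDefect F K {k} {t} U (Contains T)
    sum⇒minimal T I (i , i∈I) T⊑ ⊑T =
      positive T (subst₂ _<_ (sym dim-T) (sym weight-T) (sumOn-< I kv<nv i i∈I)) , minimal T proper
      where
      dim-T : LF.dim T ≡ sumOn I kv
      dim-T = trans (LF.dim-cong {T} {𝐹⟨ I ⟩} T⊑ ⊑T) (dim-𝐹⟨⟩ I)

      weight-T : weight T ≡ sumOn I nv
      weight-T = trans (≤-antisym (weight-mono {T} {𝐹⟨ I ⟩} T⊑) (weight-mono {𝐹⟨ I ⟩} {T} ⊑T)) (weight-𝐹⟨⟩ I)

      proper : ∀ T′ → T′ ⊑ T → (∃ λ v → v ∈ T × v ∉ T′) → weight T′ + LF.dim T < weight T + LF.dim T′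
      proper T′ T′⊑T (v , v∈T , v∉T′) = begin-strict
        weight T′ + LF.dim T                     ≡⟨ cong (weight T′ +_) (trans dim-T (sumOn-split I I′ kv I′⊆I)) ⟩
        weight T′ + (sumOn I′ kv + sumOn D kv)    ≡⟨ +-assoc (weight T′) _ _ ⟨
        (weight T′ + sumOn I′ kv) + sumOn D kv    ≤⟨ +-monoˡ-≤ (sumOn D kv) (defect-≤ scattered T′) ⟩
        (sumOn I′ nv + LF.dim T′) + sumOn D kv    <⟨ +-monoʳ-< (sumOn I′ nv + LF.dim T′) D-positive ⟩
        (sumOn I′ nv + LF.dim T′) + sumOn D nv    ≡⟨ swap (sumOn I′ nv) (LF.dim T′) (sumOn D nv) ⟩
        (sumOn I′ nv + sumOn D nv) + LF.dim T′    ≡⟨ cong (_+ LF.dim T′) (trans weight-T (sumOn-split I I′ nv I′⊆I)) ⟨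
        weight T + LF.dim T′                     ∎
        where
        open ≤-Reasoning
        I′ = components T′
        D = I ∖ I′

        swap : ∀ x y z → (x + y) + z ≡ (x + z) + y
        swap = ℕ-Solver.solve-∀

        I′⊆I : ∀ i → I′ i ≡ true → I i ≡ true
        I′⊆I i i∈I′ = 𝐹ᵢ⊑𝐹⟨⟩ I (λ v∈ → T⊑ (T′⊑T (components⁻ T′ i i∈I′ v∈)))

        D-positive : sumOn D kv < sumOn D nv
        D-positive with Fin.any? (λ i → D i Bool.≟ true)
        ... | yes (i , i∈D) = sumOn-< D kv<nv i i∈D
        ... | no none = ⊥-elim (v∉T′ (𝐹⟨components⟩⊑ T′ (LF.⨁[]-mono {I = I} {I′} 𝐹ᵢ I⊆I′ (T⊑ v∈T))))
          where
          I⊆I′ : ∀ i → I i ≡ true → I′ i ≡ true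
          I⊆I′ i i∈I = Bool.¬-not λ i∉I′ → none (i , true-∖ I I′ i i∈I i∉I′)

    characterisation : ∀ T → IsSubspace F (AllScalars F) T → Characterisation T
    characterisation T T-subspace = mk⇔
      -- Decidability of the arbitrary predicate `T` comes from the basis inside its defect here,
      -- and from its equality with a partial sum in the other direction.
      (λ { (pos@(_ , (_ , _ , _ , T-dim , _) , _) , min) →
           minimal⇒sum (LF.hasDim⇒subspace T-dim) pos min })
      (λ (I , (i , i∈I) , T⇔) → sum⇒minimal
        (record
          { Contains = T ; isSubspace = T-subspace
          ; contains? = λ v → map′ (proj₂ (T⇔ v) ∘ 𝐹⟨⟩⇒SumOver I) (SumOver⇒𝐹⟨⟩ I ∘ proj₁ (T⇔ v))
                                   (contains? 𝐹⟨ Vec.lookup I ⟩ v) })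
        (Vec.lookup I) (i , Vec.[]=⇒lookup i∈I)
        (λ {v} v∈T → SumOver⇒𝐹⟨⟩ I (proj₁ (T⇔ v) v∈T)) (λ {v} v∈F → proj₂ (T⇔ v) (𝐹⟨⟩⇒SumOver I v∈F)))

  kscattered⇒ : KScattered F K kv nv U Us → ScatteredHyperplanes
  kscattered⇒ (_ , _ , _ , cond) H dim-H no-F =
    cond (Contains H) (LF.dim H) (LF.dim⇒hasDim H) dim-H no-F
      (weight H) (LK.dim⇒hasDim (𝑈 LK.⊓ restrict H))

  -- From the classification back to scattered hyperplanes.

  module _ (char : ∀ T → IsSubspace F (AllScalars F) T → Characterisation T) where

    -- A subspace of least dimension among those inside C with positive defect is minimal
    -- with respect to its defect, hence a sum of components.
    no-positive-defect : ∀ C → (∀ i → ¬ 𝐹ᵢ i ⊑ C) → weight C ≤ LF.dim C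
    no-positive-defect C no-F = ≮⇒≥ (descend (suc (LF.dim C)) C ≤-refl id)
      where
      descend : ∀ n T → LF.dim T < n → T ⊑ C → ¬ LF.dim T < weight T
      descend (suc n) T (s≤s dim≤n) T⊑C pos =
        case Equivalence.to (char (Contains T) (isSubspace T)) (positive T pos , minimal T proper) of
          λ (I , (i , i∈I) , T⇔) → no-F i (λ {v} v∈ → T⊑C (proj₂ (T⇔ v) (𝐹⟨⟩⇒SumOver I
            (LF.⊑-⨁[] (Vec.lookup I) 𝐹ᵢ (Vec.[]=⇒lookup i∈I) v∈))))
        where
        proper : ∀ T′ → T′ ⊑ T → (∃ λ v → v ∈ T × v ∉ T′) → weight T′ + LF.dim T < weight T + LF.dim T′
        -- A proper subspace with defect at least that of `T` would again have positive defect, in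
        -- smaller dimension, which the induction excludes.
        proper T′ T′⊑T (v , v∈T , v∉T′) = ≰⇒> λ ge →
          descend n T′ (<-≤-trans (LF.dim-strict {T′} {T} T′⊑T v∈T v∉T′) dim≤n) (λ u∈ → T⊑C (T′⊑T u∈))
            (+-cancelʳ-< (LF.dim T) _ _ (<-≤-trans
              (subst (_< weight T + LF.dim T′) (+-comm (LF.dim T) _) (+-monoˡ-< (LF.dim T′) pos)) ge))

    ⇒kscattered : KScattered F K kv nv U Us
    ⇒kscattered = decomposable , kv<nv , inside-component , hyperplanes
      where
      inside-component : ∀ i (H′ : Pred (V F k) 0ℓ) (d : ℕ) → (∀ {v} → H′ v → Fcomp F K Us i v) →
        HasDim F (AllScalars F) H′ d → suc d ≡ kv i → ∀ w → HasDim F K (Us i ∩ H′) w → w ≤ d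
      inside-component i H′ d H′⊆F H′-dim d≡ w w-dim = begin
        w                                ≡⟨ LK.hasDim⇒dim (𝑈ᵢ i LK.⊓ restrict H) w-dim ⟨
        LK.dim (𝑈ᵢ i LK.⊓ restrict H)    ≤⟨ LK.dim-mono {𝑈ᵢ i LK.⊓ restrict H} {𝑈 LK.⊓ restrict H}
                                              (λ (v∈U , v∈H) → Us⊑U i v∈U , v∈H) ⟩
        weight H                         ≤⟨ no-positive-defect H no-F ⟩
        LF.dim H                         ≡⟨ dim-H ⟩
        d                                ∎
        where
        open ≤-Reasoning
        H = LF.hasDim⇒subspace H′-dim

        dim-H : LF.dim H ≡ d
        dim-H = LF.hasDim⇒dim H H′-dim

        only-i : Fin t → Bool
        only-i j = does (j Fin.≟ i)

        F⊑ : 𝐹ᵢ i ⊑ 𝐹⟨ only-i ⟩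
        F⊑ = LF.⊑-⨁[] only-i 𝐹ᵢ (dec-true (i Fin.≟ i) refl)

        -- A component inside `H` lies in `𝐹ᵢ i`, so its index is `i`; but `H` has dimension one
        -- less than `𝐹ᵢ i`.
        no-F : ∀ j → ¬ 𝐹ᵢ j ⊑ H
        no-F j Fj⊑H with j Fin.≟ i | 𝐹ᵢ⊑𝐹⟨⟩ only-i (λ v∈ → F⊑ (H′⊆F (Fj⊑H v∈)))
        ... | yes refl | _ = 1+n≰n (subst₂ _≤_
          (trans (LF.hasDim⇒dim (𝐹ᵢ i) (Fcomp-dim i)) (sym d≡)) dim-H (LF.dim-mono {𝐹ᵢ i} {H} Fj⊑H))

      hyperplanes : ∀ (H : Pred (V F k) 0ℓ) (d : ℕ) → HasDim F (AllScalars F) H d → suc d ≡ k →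
        (∀ i → ¬ (∀ {v} → Fcomp F K Us i v → H v)) → ∀ w → HasDim F K (U ∩ H) w → w ≤ d
      hyperplanes H d H-dim _ no-F w w-dim = subst₂ _≤_
        (LK.hasDim⇒dim (𝑈 LK.⊓ restrict 𝐻) w-dim) (LF.hasDim⇒dim 𝐻 H-dim)
        (no-positive-defect 𝐻 no-F)
        where 𝐻 = LF.hasDim⇒subspace H-dim

theorem1p18 : (q m : ℕ) (F : FiniteField) (K : Pred (Carrier F) 0ℓ) →
    IsSubfield F K → HasSize K q → card F ≡ q ^ m →
    (t : ℕ) (kv nv : Fin t → ℕ) → (∀ i → kv i < nv i) →
    (k : ℕ) → k ≡ sumFin kv →
    (U : Pred (V F k) 0ℓ) (Us : Fin t → Pred (V F k) 0ℓ) →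
    IsSubspace F K U → Decomposable F K kv nv U Us →
    KScattered F K kv nv U Us ⇔
    (∀ (T : Pred (V F k) 0ℓ) → IsSubspace F (AllScalars F) T →
    ((PositiveDefect F K {k} {t} U T × MinimalDefect F K {k} {t} U T) ⇔
    Σ (Subset t) (λ I → Nonempty I × (∀ v → (T v → SumOver F I (Fcomp F K Us) v)
    × (SumOver F I (Fcomp F K Us) v → T v)))))
theorem1p18 q m F K K-subfield (ks , _ , K⇒∈ , ∈⇒K , _) _ t kv nv kv<nv k k≡Σkv U Us U-subspace decomposable =
  mk⇔ (characterisation ∘ kscattered⇒) ⇒kscattered
  where
  -- The enumeration of `K` provided by `HasSize` turns membership into a finite search.
  K? : Decidable K
  K? x = map′ (∈⇒K x) (K⇒∈ x) (Any.any? (VectorSpace._≟ᶠ_ F x) ks)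
  open Decomposition F K-subfield K? {kv = kv} {nv} kv<nv k≡Σkv U-subspace decomposable
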